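{- Let $T=\{1243,2341,3412\}$ and let $F_T(x)=\sum_{n\ge0}|S_n(T)|x^n$. Then $$F_T(x)=\frac{1}{1-3x+x^2}+\frac{1}{1-x}+\frac{1-x+x^2}{(1-x)^4}-\frac{2(1-x)(1-2x-x^2)}{(1-2x)^3}.$$
   Context: $S_n$ is the set of permutations of $[n]$ ($S_0$ contains the empty permutation). A permutation avoids a pattern $\tau$ if it has no subsequence order-isomorphic to $\tau$; $S_n(T)$ is the set of permutations in $S_n$ avoiding every pattern in $T$. -}

module Defs where

open import Data.Nat using (ℕ; zero; suc)
open import Data.Integer as ℤ using (ℤ; +_; -_; _-_)
open import Data.Fin using (Fin; _<_)
import Data.Fin as F
open import Data.Vec using (Vec; lookup; []; _∷_)
open import Data.List as List using (List; []; _∷_; zipWith; drop; length; foldr)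
open import Data.Product using (Σ; _×_; ∃)
open import Relation.Binary.PropositionalEquality using (_≡_)
open import Relation.Nullary using (¬_)

-- A permutation of [n] is represented (0-based) by its one-line notation
-- σ = σ(0) σ(1) … σ(n-1), a vector of length n over Fin n whose entries
-- are pairwise distinct.
IsPerm : {n : ℕ} → Vec (Fin n) n → Set
IsPerm {n} σ = (i j : Fin n) → lookup σ i ≡ lookup σ j → i ≡ j

-- σ contains the pattern τ (of length k) if there are positions
-- f(0) < f(1) < … < f(k-1) such that σ(f(0)) … σ(f(k-1)) is
-- order-isomorphic to τ.  (Both σ and τ have distinct entries, so
-- preserving strict order of values is order-isomorphism.)
Contains : {n k : ℕ} → Vec (Fin n) n → Vec (Fin k) k → Set
Contains {n} {k} σ τ =
  Σ (Fin k → Fin n) λ f →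
    ((a b : Fin k) → a < b → f a < f b) ×
    ((a b : Fin k) → lookup τ a < lookup τ b → lookup σ (f a) < lookup σ (f b))

Avoids : {n k : ℕ} → Vec (Fin n) n → Vec (Fin k) k → Set
Avoids σ τ = ¬ Contains σ τ

p1243 p2341 p3412 : Vec (Fin 4) 4
p1243 = F.zero ∷ F.suc F.zero ∷ F.suc (F.suc (F.suc F.zero)) ∷ F.suc (F.suc F.zero) ∷ []
p2341 = F.suc F.zero ∷ F.suc (F.suc F.zero) ∷ F.suc (F.suc (F.suc F.zero)) ∷ F.zero ∷ []
p3412 = F.suc (F.suc F.zero) ∷ F.suc (F.suc (F.suc F.zero)) ∷ F.zero ∷ F.suc F.zero ∷ []

InS-T : {n : ℕ} → Vec (Fin n) n → Set
InS-T σ = IsPerm σ × Avoids σ p1243 × Avoids σ p2341 × Avoids σ p3412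

-- Formal power series over ℤ (as coefficient functions) and rational
-- series P(x)/Q(x) for polynomials given by coefficient lists
-- (constant term first).

Poly : Set
Poly = List ℤ

coeffP : Poly → ℕ → ℤ
coeffP []       _       = + 0
coeffP (a ∷ _)  zero    = a
coeffP (_ ∷ as) (suc n) = coeffP as n

_+P_ : Poly → Poly → Poly
[]       +P q        = q
p        +P []       = p
(a ∷ p)  +P (b ∷ q)  = (a ℤ.+ b) ∷ (p +P q)

scaleP : ℤ → Poly → Poly
scaleP c = List.map (c ℤ.*_)

_*P_ : Poly → Poly → Poly
[]      *P q = []
(a ∷ p) *P q = scaleP a q +P (+ 0 ∷ (p *P q))

_^P_ : Poly → ℕ → Poly
p ^P zero  = + 1 ∷ []
p ^P suc n = p *P (p ^P n)

-- Coefficients of the power series P(x)/Q(x), where Q has constant term 1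
-- (all denominators used below do).  If c = P/Q then c·Q = P, i.e.
--   c_n = p_n - Σ_{k≥1} q_k c_{n-k}.
-- prefixR p q n = [c_n, c_{n-1}, …, c_0]  (newest first)
prefixR : Poly → Poly → ℕ → List ℤ
prefixR p q zero    = coeffP p 0 ∷ []
prefixR p q (suc n) =
  (coeffP p (suc n) - foldr ℤ._+_ (+ 0) (zipWith ℤ._*_ (drop 1 q) (prefixR p q n))) ∷ prefixR p q n

headZ : List ℤ → ℤ
headZ []      = + 0
headZ (a ∷ _) = a

ratCoeff : Poly → Poly → ℕ → ℤ
ratCoeff p q n = headZ (prefixR p q n)

X : Poly
X = + 0 ∷ + 1 ∷ []

one : Poly
one = + 1 ∷ []

_-P_ : Poly → Poly → Poly
p -P q = p +P scaleP (- + 1) q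

rhsCoeff : ℕ → ℤ
rhsCoeff n =
    ratCoeff one ((one -P scaleP (+ 3) X) +P (X *P X)) n
  ℤ.+ ratCoeff one (one -P X) n
  ℤ.+ ratCoeff ((one -P X) +P (X *P X)) ((one -P X) ^P 4) n
  - ratCoeff (scaleP (+ 2) ((one -P X) *P ((one -P scaleP (+ 2) X) -P (X *P X))))
             ((one -P scaleP (+ 2) X) ^P 3) n

{-# OPTIONS --safe #-}
module Submission where

open import Defs
open import Data.Nat using (ℕ; zero; suc; _≤_; _<_; z≤n; s≤s; s≤s⁻¹)
import Data.Nat as ℕ
open import Data.Nat.Properties
  using (≤-refl; ≤-reflexive; ≤-trans; ≤-antisym; ≤-<-trans; <-≤-trans; <-trans; <-irrefl; <⇒≤; <⇒≢; ≰⇒>; n≮0; 1+n≰n;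
         ≤-<-connex; n≤1+n; m≤m+n; m≤n+m; m<n⇒m<1+n; m≤n⇒m<n∨m≡n)
import Data.Nat.Properties as ℕ
open import Data.Integer using (ℤ; +_; -[1+_]; _+_; _*_; _-_)
import Data.Integer.Properties as ℤ
open import Data.Integer.Tactic.RingSolver using (solve-∀)
open import Data.Fin using (Fin; toℕ; punchIn; punchOut; fromℕ<)
import Data.Fin as Fin
open import Data.Fin.Patterns using (0F; 1F; 2F; 3F)
open import Data.Fin.Properties
  using (toℕ<n; toℕ-fromℕ<; toℕ-injective; any?; injective⇒≤; punchIn-mono-≤; punchIn-cancel-≤; punchIn-injective;
         punchInᵢ≢i; punchIn-punchOut; punchOut-injective)
import Data.Fin.Properties as Fin
open import Data.Vec using (Vec; []; _∷_; lookup; tabulate; insertAt)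
import Data.Vec as Vec
open import Data.Vec.Properties
  using (insertAt-lookup; insertAt-punchIn; lookup-map; lookup∘tabulate; tabulate∘lookup; tabulate-cong)
open import Data.List using (List; []; _∷_; _++_; concatMap; length; foldr; zipWith; drop)
import Data.List as List
open import Data.List.Properties using (++-identityʳ; length-map)
open import Data.List.Relation.Unary.All using (All; []; _∷_)
import Data.List.Relation.Unary.All as All
import Data.List.Relation.Unary.All.Properties as All
open import Data.List.Relation.Unary.AllPairs using (AllPairs; []; _∷_)
import Data.List.Relation.Unary.AllPairs as AllPairs
import Data.List.Relation.Unary.AllPairs.Properties as AllPairs
open import Data.List.Relation.Unary.Any using (here; there)
open import Data.List.Relation.Unary.Unique.Propositional using (Unique)
open import Data.List.Membership.Propositional using (_∈_)
open import Data.List.Membership.Propositional.Properties using (∈-map⁺; ∈-map⁻; ∈-++⁺ˡ; ∈-++⁺ʳ; ∈-concat⁺′)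
open import Data.Product using (Σ; ∃; ∃₂; _×_; _,_; proj₁; proj₂)
open import Data.Sum using (_⊎_; inj₁; inj₂)
open import Data.Unit using (⊤; tt)
open import Function using (_∘_; _on_)
open import Function.Bundles using (_⇔_; mk⇔)
open import Relation.Nullary using (¬_; yes; no; contradiction)
open import Relation.Binary.PropositionalEquality
  using (_≡_; _≢_; refl; sym; trans; cong; cong₂; subst; subst₂; module ≡-Reasoning)

-- Build permutations by inserting a new minimum into a shorter one.  A site (gap between entries) s is active if
-- inserting there creates no forbidden pattern, i.e. if the suffix after s avoids 132, the prefix before s avoids 123,
-- and no ascent in the prefix has its bottom above an entry of the suffix.  How the active sites change under an
-- insertion depends only on which segments between sites are decreasing and which suffixes are increasing, and this
-- leads to a generating tree whose labels form finitely many families with at most one parameter k that affects the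
-- counts.  The generating function of the subtree below a label is a(x) / (1 - x)^k + k b(x) + c(x) with rational
-- a, b, c depending on the family only; the coefficients of these series are verified by induction on the depth.

-- Active sites and their change under insertion of a minimum

-- An entry below all others can only play the 1 of a forbidden pattern. After an insertion at p, a
-- site s ≤ p has the new minimum in its suffix: every ascent before s now has its bottom above an
-- entry of that suffix, so the prefix must be decreasing, and a descent behind p would complete a
-- 132. A site behind p has the minimum in its prefix, where an ascent between the two would
-- complete a 123. Nothing else changes, and the facts about decreasing segments and increasing
-- suffixes that this consumes can be updated from facts of the same two kinds. Hence the labels
-- never have to mention values.
--
-- The denominators can be read off the tree. A label `D j` has the children `D j` and `D (suc j)`;
-- with the order of the pole at 1 growing along j this leads to (1 - x)^2 - x = 1 - 3x + x^2. The
-- cube of 1 - 2x comes from three nested doublings: `P` has two children of its own kind, the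
-- coefficient of j in the count of `D j` doubles at each level while collecting the count of `P`
-- through `B`, and the constant term of `D j` doubles while collecting that coefficient.

module _ {n : ℕ} (f : Fin n → ℕ) where

  NoAscent : ℕ → ℕ → Set
  NoAscent s t = ∀ x y → x Fin.< y → s ≤ toℕ x → toℕ y < t → ¬ f x < f y

  NoDescentFrom : ℕ → Set
  NoDescentFrom s = ∀ x y → x Fin.< y → s ≤ toℕ x → ¬ f y < f x

  -- A new minimum in front of position s plays the 1 of 1243, of 2341 or of 3412 respectively.
  Blocks1243 Blocks2341 Blocks3412 : ℕ → Set
  Blocks1243 s = ∃ λ x → ∃ λ y → ∃ λ z →
    x Fin.< y × y Fin.< z × s ≤ toℕ x × f x < f z × f z < f y
  Blocks2341 s = ∃ λ x → ∃ λ y → ∃ λ z →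
    x Fin.< y × y Fin.< z × toℕ z < s × f x < f y × f y < f z
  Blocks3412 s = ∃ λ x → ∃ λ y → ∃ λ z →
    x Fin.< y × toℕ y < s × s ≤ toℕ z × f z < f x × f x < f y

  Active : ℕ → Set
  Active s = s ≤ n × ¬ Blocks1243 s × ¬ Blocks2341 s × ¬ Blocks3412 s

  Has1243 Has2341 Has3412 : Set
  Has1243 = ∃ λ w → ∃ λ x → ∃ λ y → ∃ λ z → w Fin.< x × x Fin.< y × y Fin.< z ×
    f w < f x × f x < f z × f z < f y
  Has2341 = ∃ λ w → ∃ λ x → ∃ λ y → ∃ λ z → w Fin.< x × x Fin.< y × y Fin.< z ×
    f z < f w × f w < f x × f x < f y
  Has3412 = ∃ λ w → ∃ λ x → ∃ λ y → ∃ λ z → w Fin.< x × x Fin.< y × y Fin.< z ×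
    f y < f z × f z < f w × f w < f x

  Avoiding : Set
  Avoiding = ¬ Has1243 × ¬ Has2341 × ¬ Has3412

-- `S s t` is meant for the entries between the sites s and t, `I s` for those behind s. Keeping the
-- predicates abstract lets the case analysis over labels run without inspecting positions or
-- values.
record Profile : Set₁ where
  field
    size      : ℕ
    A         : ℕ → Set
    S         : ℕ → ℕ → Set
    I         : ℕ → Set
    A-bounded : ∀ {s} → A s → s ≤ size
    S-mono    : ∀ {s s′ t t′} → s ≤ s′ → t′ ≤ t → S s t → S s′ t′
    S-short   : ∀ {s t} → t ≤ suc s → S s t
    I-mono    : ∀ {s s′} → s ≤ s′ → I s → I s′

profile : ∀ {n} → (Fin n → ℕ) → Profile
profile {n} f = record
  { size      = n
  ; A         = Active f
  ; S         = NoAscent f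
  ; I         = NoDescentFrom f
  ; A-bounded = proj₁
  ; S-mono    = λ s≤s′ t′≤t h x y x<y s′≤x y<t′ → h x y x<y (≤-trans s≤s′ s′≤x) (<-≤-trans y<t′ t′≤t)
  ; S-short   = λ t≤1+s x y x<y s≤x y<t _ →
      <-irrefl refl (<-≤-trans (≤-<-trans s≤x x<y) (s≤s⁻¹ (≤-trans y<t t≤1+s)))
  ; I-mono    = λ s≤s′ h x y x<y s′≤x → h x y x<y (≤-trans s≤s′ s′≤x)
  }

-- The old site p splits into p and p+1, in front of and behind the minimum. A site up to p keeps
-- its index (low), and an old site t from p on becomes t+1 (high). For segments, mid means ending
-- directly behind the minimum, where it extends a decreasing segment; any longer segment that
-- contains the minimum has an ascent.
record Inserted (Q Q′ : Profile) (p : ℕ) : Set where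
  private
    module Q  = Profile Q
    module Q′ = Profile Q′
  field
    A-low⇒  : ∀ {s} → s ≤ p → Q′.A s → Q.A s × Q.S 0 s × Q.I p
    A-low⇐  : ∀ {s} → s ≤ p → Q.A s → Q.S 0 s → Q.I p → Q′.A s
    A-high⇒ : ∀ {t} → p ≤ t → Q′.A (suc t) → Q.A t × Q.S p t
    A-high⇐ : ∀ {t} → p ≤ t → Q.A t → Q.S p t → Q′.A (suc t)
    S-low⇐  : ∀ {s t} → t ≤ p → Q.S s t → Q′.S s t
    S-mid⇒  : ∀ {s} → s ≤ p → Q′.S s (suc p) → Q.S s p
    S-mid⇐  : ∀ {s} → s ≤ p → Q.S s p → Q′.S s (suc p)
    S-mid✗  : ∀ {s t} → s ≤ p → p < t → t ≤ Q.size → ¬ Q′.S s (suc t)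
    S-high⇐ : ∀ {s t} → p ≤ s → Q.S s t → Q′.S (suc s) (suc t)
    I-low✗  : ∀ {s} → s < p → ¬ Q′.I s
    I-mid⇐  : Q.I p → Q′.I p
    I-high⇒ : ∀ {t} → p ≤ t → Q′.I (suc t) → Q.I t
    I-high⇐ : ∀ {t} → p ≤ t → Q.I t → Q′.I (suc t)

module _ {n : ℕ} (p : Fin (suc n)) where

  punchIn-view : ∀ x → x ≡ p ⊎ ∃ λ y → x ≡ punchIn p y
  punchIn-view x with p Fin.≟ x
  ... | yes p≡x = inj₁ (sym p≡x)
  ... | no  p≢x = inj₂ (punchOut p≢x , sym (punchIn-punchOut p≢x))

toℕ-punchIn : ∀ {n} (p : Fin (suc n)) y →
  (toℕ y < toℕ p × toℕ (punchIn p y) ≡ toℕ y) ⊎ (toℕ p ≤ toℕ y × toℕ (punchIn p y) ≡ suc (toℕ y))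
toℕ-punchIn Fin.zero    y           = inj₂ (z≤n , refl)
toℕ-punchIn (Fin.suc p) Fin.zero    = inj₁ (s≤s z≤n , refl)
toℕ-punchIn (Fin.suc p) (Fin.suc y) with toℕ-punchIn p y
... | inj₁ (y<p , eq) = inj₁ (s≤s y<p , cong suc eq)
... | inj₂ (p≤y , eq) = inj₂ (s≤s p≤y , cong suc eq)

module InsertMin {n : ℕ} (p : Fin (suc n)) (f : Fin n → ℕ) (f′ : Fin (suc n) → ℕ)
  (f′-p : f′ p ≡ 0) (f′-punchIn : ∀ y → f′ (punchIn p y) ≡ suc (f y)) where

  private
    ι : Fin n → Fin (suc n)
    ι = punchIn p

    ι-mono : ∀ {x y} → x Fin.< y → ι x Fin.< ι y
    ι-mono {x} {y} x<y = ≰⇒> λ ιy≤ιx → <-irrefl refl (<-≤-trans x<y (punchIn-cancel-≤ p y x ιy≤ιx))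

    ι-cancel : ∀ {x y} → ι x Fin.< ι y → x Fin.< y
    ι-cancel {x} {y} ιx<ιy = ≰⇒> λ y≤x → <-irrefl refl (<-≤-trans ιx<ιy (punchIn-mono-≤ p y x y≤x))

    ≤ι : ∀ y → toℕ y ≤ toℕ (ι y)
    ≤ι y with toℕ-punchIn p y
    ... | inj₁ (_ , eq) = ≤-reflexive (sym eq)
    ... | inj₂ (_ , eq) = ≤-trans (n≤1+n _) (≤-reflexive (sym eq))

    -- In this family, low compares with a site that keeps its index and high with one that moves up
    -- by one; ⇒ passes from the new sequence to the old one.
    low<⇒ : ∀ {s} y → toℕ (ι y) < s → toℕ y < s
    low<⇒ y = ≤-<-trans (≤ι y)

    low<⇐ : ∀ {s} y → s ≤ toℕ p → toℕ y < s → toℕ (ι y) < s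
    low<⇐ y s≤p y<s with toℕ-punchIn p y
    ... | inj₁ (_ , eq)   = subst (_< _) (sym eq) y<s
    ... | inj₂ (p≤y , eq) = contradiction (<-≤-trans y<s (≤-trans s≤p p≤y)) (<-irrefl refl)

    low≤⇒ : ∀ {s} y → s ≤ toℕ p → s ≤ toℕ (ι y) → s ≤ toℕ y
    low≤⇒ y s≤p s≤ιy with toℕ-punchIn p y
    ... | inj₁ (_ , eq)   = subst (_ ≤_) eq s≤ιy
    ... | inj₂ (p≤y , eq) = ≤-trans s≤p p≤y

    low≤⇐ : ∀ {s} y → s ≤ toℕ y → s ≤ toℕ (ι y)
    low≤⇐ y s≤y = ≤-trans s≤y (≤ι y)

    high<⇒ : ∀ {t} y → toℕ p ≤ t → toℕ (ι y) < suc t → toℕ y < t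
    high<⇒ y p≤t (s≤s ιy≤t) with toℕ-punchIn p y
    ... | inj₁ (y<p , eq) = <-≤-trans y<p p≤t
    ... | inj₂ (_ , eq)   = subst (_≤ _) eq ιy≤t

    high<⇐ : ∀ {t} y → toℕ y < t → toℕ (ι y) < suc t
    high<⇐ y y<t with toℕ-punchIn p y
    ... | inj₁ (_ , eq) = subst (_< _) (sym eq) (m<n⇒m<1+n y<t)
    ... | inj₂ (_ , eq) = subst (_< _) (sym eq) (s≤s y<t)

    high≤⇒ : ∀ {t} y → suc t ≤ toℕ (ι y) → t ≤ toℕ y
    high≤⇒ y t<ιy with toℕ-punchIn p y
    ... | inj₁ (_ , eq) = <⇒≤ (subst (_ ≤_) eq t<ιy)
    ... | inj₂ (_ , eq) with subst (_ ≤_) eq t<ιy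
    ...   | s≤s t≤y = t≤y

    high≤⇐ : ∀ {t} y → toℕ p ≤ t → t ≤ toℕ y → suc t ≤ toℕ (ι y)
    high≤⇐ y p≤t t≤y with toℕ-punchIn p y
    ... | inj₁ (y<p , eq) = contradiction (<-≤-trans y<p (≤-trans p≤t t≤y)) (<-irrefl refl)
    ... | inj₂ (_ , eq)   = subst (_ ≤_) (sym eq) (s≤s t≤y)

    f′-mono : ∀ {x y} → f x < f y → f′ (ι x) < f′ (ι y)
    f′-mono {x} {y} fx<fy rewrite f′-punchIn x | f′-punchIn y = s≤s fx<fy

    f′-cancel : ∀ {x y} → f′ (ι x) < f′ (ι y) → f x < f y
    f′-cancel {x} {y} lt rewrite f′-punchIn x | f′-punchIn y with lt
    ... | s≤s fx<fy = fx<fy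

    f′p< : ∀ y → f′ p < f′ (ι y)
    f′p< y rewrite f′-p | f′-punchIn y = s≤s z≤n

    ≮f′p : ∀ {x} → ¬ f′ x < f′ p
    ≮f′p {x} lt = n≮0 (subst (f′ x <_) f′-p lt)

    at : ∀ {t} → t < suc n → ∃ λ x → toℕ x ≡ t
    at t<1+n = fromℕ< t<1+n , toℕ-fromℕ< t<1+n

  S-low⇐ : ∀ {s t} → t ≤ toℕ p → NoAscent f s t → NoAscent f′ s t
  S-low⇐ t≤p h x y x<y s≤x y<t lt with punchIn-view p x | punchIn-view p y
  ... | _               | inj₁ refl       = ≮f′p lt
  ... | inj₁ refl       | inj₂ (b , refl) = <-irrefl refl (<-≤-trans (≤-<-trans (<⇒≤ x<y) y<t) t≤p)
  ... | inj₂ (a , refl) | inj₂ (b , refl) =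
    h a b (ι-cancel x<y) (low≤⇒ a (<⇒≤ (≤-<-trans s≤x (<-≤-trans (≤-<-trans (<⇒≤ x<y) y<t) t≤p))) s≤x)
      (low<⇒ b y<t) (f′-cancel lt)

  S-mid⇒ : ∀ {s} → s ≤ toℕ p → NoAscent f′ s (suc (toℕ p)) → NoAscent f s (toℕ p)
  S-mid⇒ s≤p h x y x<y s≤x y<p fx<fy =
    h (ι x) (ι y) (ι-mono x<y) (low≤⇐ x s≤x) (high<⇐ y y<p) (f′-mono fx<fy)

  S-mid⇐ : ∀ {s} → s ≤ toℕ p → NoAscent f s (toℕ p) → NoAscent f′ s (suc (toℕ p))
  S-mid⇐ s≤p h x y x<y s≤x y<1+p lt with punchIn-view p x | punchIn-view p y
  ... | _               | inj₁ refl       = ≮f′p lt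
  ... | inj₁ refl       | inj₂ (b , refl) = <-irrefl refl (<-≤-trans x<y (s≤s⁻¹ y<1+p))
  ... | inj₂ (a , refl) | inj₂ (b , refl) =
    h a b (ι-cancel x<y) (low≤⇒ a s≤p s≤x) (high<⇒ b ≤-refl y<1+p) (f′-cancel lt)

  -- The minimum and the last entry of the segment, at position `t`, form an ascent; `t ≤ n` ensures
  -- that this entry exists.
  S-mid✗ : ∀ {s t} → s ≤ toℕ p → toℕ p < t → t ≤ n → ¬ NoAscent f′ s (suc t)
  S-mid✗ {t = t} s≤p p<t t≤n h with at (s≤s t≤n)
  ... | y , refl with punchIn-view p y
  ...   | inj₁ refl       = <-irrefl refl p<t
  ...   | inj₂ (b , refl) = h p (ι b) p<t s≤p ≤-refl (f′p< b)

  S-high⇐ : ∀ {s t} → toℕ p ≤ s → NoAscent f s t → NoAscent f′ (suc s) (suc t)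
  S-high⇐ p≤s h x y x<y s<x y<1+t lt with punchIn-view p x | punchIn-view p y
  ... | _               | inj₁ refl       = ≮f′p lt
  ... | inj₁ refl       | inj₂ (b , refl) = <-irrefl refl (<-≤-trans s<x p≤s)
  ... | inj₂ (a , refl) | inj₂ (b , refl) =
    -- The long argument of `high<⇒` proves `toℕ p ≤ t`, from p ≤ s < x < y ≤ t.
    h a b (ι-cancel x<y) (high≤⇒ a s<x) (high<⇒ b (≤-trans p≤s (≤-trans (n≤1+n _) (≤-trans s<x (s≤s⁻¹ (≤-trans x<y (<⇒≤ y<1+t)))))) y<1+t)
      (f′-cancel lt)

  I-low✗ : ∀ {s} → s < toℕ p → ¬ NoDescentFrom f′ s
  I-low✗ s<p h with at (<-≤-trans s<p (<⇒≤ (toℕ<n p)))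
  ... | x , refl with punchIn-view p x
  ...   | inj₁ refl       = <-irrefl refl s<p
  ...   | inj₂ (a , refl) = h (ι a) p s<p ≤-refl (f′p< a)

  I-mid⇐ : NoDescentFrom f (toℕ p) → NoDescentFrom f′ (toℕ p)
  I-mid⇐ h x y x<y p≤x lt with punchIn-view p x | punchIn-view p y
  ... | inj₁ refl       | _               = ≮f′p lt
  ... | inj₂ (a , refl) | inj₁ refl       = <-irrefl refl (<-≤-trans x<y p≤x)
  ... | inj₂ (a , refl) | inj₂ (b , refl) = h a b (ι-cancel x<y) (low≤⇒ a ≤-refl p≤x) (f′-cancel lt)

  I-high⇒ : ∀ {t} → toℕ p ≤ t → NoDescentFrom f′ (suc t) → NoDescentFrom f t
  I-high⇒ p≤t h x y x<y t≤x lt = h (ι x) (ι y) (ι-mono x<y) (high≤⇐ x p≤t t≤x) (f′-mono lt)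

  I-high⇐ : ∀ {t} → toℕ p ≤ t → NoDescentFrom f t → NoDescentFrom f′ (suc t)
  I-high⇐ p≤t h x y x<y t<x lt with punchIn-view p x | punchIn-view p y
  ... | inj₁ refl       | _               = ≮f′p lt
  ... | inj₂ (a , refl) | inj₁ refl       = <-irrefl refl (<-≤-trans (<-≤-trans t<x (<⇒≤ x<y)) p≤t)
  ... | inj₂ (a , refl) | inj₂ (b , refl) = h a b (ι-cancel x<y) (high≤⇒ a t<x) (f′-cancel lt)

  A-low⇒ : ∀ {s} → s ≤ toℕ p → Active f′ s → Active f s × NoAscent f 0 s × NoDescentFrom f (toℕ p)
  A-low⇒ {s} s≤p (s≤1+n , ¬b1243 , ¬b2341 , ¬b3412) =
    (≤-trans s≤p (s≤s⁻¹ (toℕ<n p)) , ¬1243 ,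
      (λ { (x , y , z , x<y , y<z , z<s , fx<fy , _) → pd x y x<y z≤n (<-≤-trans y<z (<⇒≤ z<s)) fx<fy }) ,
      (λ { (x , y , z , x<y , y<s , _ , _ , fx<fy) → pd x y x<y z≤n y<s fx<fy })) ,
    pd , inc
    where
    pd : NoAscent f 0 s
    pd x y x<y _ y<s fx<fy = ¬b3412 (ι x , ι y , p , ι-mono x<y , low<⇐ y s≤p y<s , s≤p , f′p< x , f′-mono fx<fy)

    inc : NoDescentFrom f (toℕ p)
    inc x y x<y p≤x fy<fx =
      ¬b1243 (p , ι x , ι y , high≤⇐ x ≤-refl p≤x , ι-mono x<y , s≤p , f′p< y , f′-mono fy<fx)

    ¬1243 : ¬ Blocks1243 f s
    ¬1243 (x , y , z , x<y , y<z , s≤x , fx<fz , fz<fy) =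
      ¬b1243 (ι x , ι y , ι z , ι-mono x<y , ι-mono y<z , low≤⇐ x s≤x , f′-mono fx<fz , f′-mono fz<fy)

  A-low⇐ : ∀ {s} → s ≤ toℕ p → Active f s → NoAscent f 0 s → NoDescentFrom f (toℕ p) → Active f′ s
  A-low⇐ {s} s≤p (s≤n , ¬b1243 , _ , _) pd inc =
    ≤-trans s≤n (n≤1+n _) , ¬1243 ,
    (λ { (x , y , z , x<y , y<z , z<s , fx<fy , _) →
      S-low⇐ s≤p pd x y x<y z≤n (<-≤-trans y<z (<⇒≤ z<s)) fx<fy }) ,
    (λ { (x , y , z , x<y , y<s , _ , _ , fx<fy) → S-low⇐ s≤p pd x y x<y z≤n y<s fx<fy })
    where
    ¬1243 : ¬ Blocks1243 f′ s
    ¬1243 (x , y , z , x<y , y<z , s≤x , fx<fz , fz<fy)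
      with punchIn-view p x | punchIn-view p y | punchIn-view p z
    ... | _               | inj₁ refl       | _               = ≮f′p fz<fy
    ... | _               | inj₂ _          | inj₁ refl       = ≮f′p fx<fz
    ... | inj₁ refl       | inj₂ (b , refl) | inj₂ (c , refl) =
      inc b c (ι-cancel y<z) (high≤⇒ b x<y) (f′-cancel fz<fy)
    ... | inj₂ (a , refl) | inj₂ (b , refl) | inj₂ (c , refl) =
      ¬b1243 (a , b , c , ι-cancel x<y , ι-cancel y<z , low≤⇒ a s≤p s≤x , f′-cancel fx<fz , f′-cancel fz<fy)

  A-high⇒ : ∀ {t} → toℕ p ≤ t → Active f′ (suc t) → Active f t × NoAscent f (toℕ p) t
  A-high⇒ {t} p≤t (s≤s t≤n , ¬b1243 , ¬b2341 , ¬b3412) =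
    (t≤n ,
      (λ { (x , y , z , x<y , y<z , t≤x , fx<fz , fz<fy) →
        ¬b1243 (ι x , ι y , ι z , ι-mono x<y , ι-mono y<z , high≤⇐ x p≤t t≤x , f′-mono fx<fz , f′-mono fz<fy) }) ,
      (λ { (x , y , z , x<y , y<z , z<t , fx<fy , fy<fz) →
        ¬b2341 (ι x , ι y , ι z , ι-mono x<y , ι-mono y<z , high<⇐ z z<t , f′-mono fx<fy , f′-mono fy<fz) }) ,
      (λ { (x , y , z , x<y , y<t , t≤z , fz<fx , fx<fy) →
        ¬b3412 (ι x , ι y , ι z , ι-mono x<y , high<⇐ y y<t , high≤⇐ z p≤t t≤z , f′-mono fz<fx , f′-mono fx<fy) })) ,
    λ x y x<y p≤x y<t fx<fy →
      ¬b2341 (p , ι x , ι y , high≤⇐ x ≤-refl p≤x , ι-mono x<y , high<⇐ y y<t , f′p< x , f′-mono fx<fy)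

  A-high⇐ : ∀ {t} → toℕ p ≤ t → Active f t → NoAscent f (toℕ p) t → Active f′ (suc t)
  A-high⇐ {t} p≤t (t≤n , ¬b1243 , ¬b2341 , ¬b3412) seg = s≤s t≤n , ¬1243 , ¬2341 , ¬3412
    where
    ¬1243 : ¬ Blocks1243 f′ (suc t)
    ¬1243 (x , y , z , x<y , y<z , t<x , fx<fz , fz<fy)
      with punchIn-view p x | punchIn-view p y | punchIn-view p z
    ... | _               | inj₁ refl       | _               = ≮f′p fz<fy
    ... | _               | inj₂ _          | inj₁ refl       = ≮f′p fx<fz
    ... | inj₁ refl       | inj₂ (b , refl) | inj₂ (c , refl) = <-irrefl refl (<-≤-trans t<x p≤t)
    ... | inj₂ (a , refl) | inj₂ (b , refl) | inj₂ (c , refl) =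
      ¬b1243 (a , b , c , ι-cancel x<y , ι-cancel y<z , high≤⇒ a t<x , f′-cancel fx<fz , f′-cancel fz<fy)

    ¬2341 : ¬ Blocks2341 f′ (suc t)
    ¬2341 (x , y , z , x<y , y<z , z<t , fx<fy , fy<fz)
      with punchIn-view p x | punchIn-view p y | punchIn-view p z
    ... | _               | inj₁ refl       | _               = ≮f′p fx<fy
    ... | _               | inj₂ _          | inj₁ refl       = ≮f′p fy<fz
    ... | inj₁ refl       | inj₂ (b , refl) | inj₂ (c , refl) =
      seg b c (ι-cancel y<z) (high≤⇒ b x<y) (high<⇒ c p≤t z<t) (f′-cancel fy<fz)
    ... | inj₂ (a , refl) | inj₂ (b , refl) | inj₂ (c , refl) =
      ¬b2341 (a , b , c , ι-cancel x<y , ι-cancel y<z , high<⇒ c p≤t z<t , f′-cancel fx<fy , f′-cancel fy<fz)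

    ¬3412 : ¬ Blocks3412 f′ (suc t)
    ¬3412 (x , y , z , x<y , y<t , t<z , fz<fx , fx<fy)
      with punchIn-view p x | punchIn-view p y | punchIn-view p z
    ... | inj₁ refl       | _               | _               = ≮f′p fz<fx
    ... | inj₂ _          | inj₁ refl       | _               = ≮f′p fx<fy
    ... | inj₂ _          | inj₂ _          | inj₁ refl       = <-irrefl refl (<-≤-trans t<z p≤t)
    ... | inj₂ (a , refl) | inj₂ (b , refl) | inj₂ (c , refl) =
      ¬b3412 (a , b , c , ι-cancel x<y , high<⇒ b p≤t y<t , high≤⇒ c t<z , f′-cancel fz<fx , f′-cancel fx<fy)

  inserted : Inserted (profile f) (profile f′) (toℕ p)
  inserted = record
    { A-low⇒ = A-low⇒ ; A-low⇐ = A-low⇐ ; A-high⇒ = A-high⇒ ; A-high⇐ = A-high⇐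
    ; S-low⇐ = S-low⇐ ; S-mid⇒ = S-mid⇒ ; S-mid⇐ = S-mid⇐ ; S-mid✗ = S-mid✗
    ; S-high⇐ = S-high⇐
    ; I-low✗ = I-low✗ ; I-mid⇐ = I-mid⇐ ; I-high⇒ = I-high⇒ ; I-high⇐ = I-high⇐
    }

  avoiding⇒ : Avoiding f′ → Avoiding f × Active f (toℕ p)
  avoiding⇒ (¬h1243 , ¬h2341 , ¬h3412) =
    ( (λ { (w , x , y , z , w<x , x<y , y<z , a , b , c) →
         ¬h1243 (ι w , ι x , ι y , ι z , ι-mono w<x , ι-mono x<y , ι-mono y<z , f′-mono a , f′-mono b , f′-mono c) })
    , (λ { (w , x , y , z , w<x , x<y , y<z , a , b , c) →
         ¬h2341 (ι w , ι x , ι y , ι z , ι-mono w<x , ι-mono x<y , ι-mono y<z , f′-mono a , f′-mono b , f′-mono c) })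
    , (λ { (w , x , y , z , w<x , x<y , y<z , a , b , c) →
         ¬h3412 (ι w , ι x , ι y , ι z , ι-mono w<x , ι-mono x<y , ι-mono y<z , f′-mono a , f′-mono b , f′-mono c) })) ,
    ( s≤s⁻¹ (toℕ<n p)
    , (λ { (x , y , z , x<y , y<z , p≤x , fx<fz , fz<fy) →
         ¬h1243 (p , ι x , ι y , ι z , high≤⇐ x ≤-refl p≤x , ι-mono x<y , ι-mono y<z , f′p< x , f′-mono fx<fz , f′-mono fz<fy) })
    , (λ { (x , y , z , x<y , y<z , z<p , fx<fy , fy<fz) →
         ¬h2341 (ι x , ι y , ι z , p , ι-mono x<y , ι-mono y<z , low<⇐ z ≤-refl z<p , f′p< x , f′-mono fx<fy , f′-mono fy<fz) })
    , (λ { (x , y , z , x<y , y<p , p≤z , fz<fx , fx<fy) →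
         ¬h3412 (ι x , ι y , p , ι z , ι-mono x<y , low<⇐ y ≤-refl y<p , high≤⇐ z ≤-refl p≤z , f′p< z , f′-mono fz<fx , f′-mono fx<fy) }))

  -- An occurrence that uses the minimum as anything but the 1 is absurd, one that uses it as the 1
  -- blocks the site, and one that misses it already occurs in `f`.
  avoiding⇐ : Avoiding f → Active f (toℕ p) → Avoiding f′
  avoiding⇐ (¬h1243 , ¬h2341 , ¬h3412) (_ , ¬b1243 , ¬b2341 , ¬b3412) = ¬1243 , ¬2341 , ¬3412
    where
    ¬1243 : ¬ Has1243 f′
    ¬1243 (w , x , y , z , w<x , x<y , y<z , fw<fx , fx<fz , fz<fy)
      with punchIn-view p w | punchIn-view p x | punchIn-view p y | punchIn-view p z
    ... | _               | inj₁ refl       | _               | _               = ≮f′p fw<fx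
    ... | _               | inj₂ _          | inj₁ refl       | _               = ≮f′p fz<fy
    ... | _               | inj₂ _          | inj₂ _          | inj₁ refl       = ≮f′p fx<fz
    ... | inj₁ refl       | inj₂ (b , refl) | inj₂ (c , refl) | inj₂ (d , refl) =
      ¬b1243 (b , c , d , ι-cancel x<y , ι-cancel y<z , high≤⇒ b w<x , f′-cancel fx<fz , f′-cancel fz<fy)
    ... | inj₂ (a , refl) | inj₂ (b , refl) | inj₂ (c , refl) | inj₂ (d , refl) =
      ¬h1243 (a , b , c , d , ι-cancel w<x , ι-cancel x<y , ι-cancel y<z ,
        f′-cancel fw<fx , f′-cancel fx<fz , f′-cancel fz<fy)

    ¬2341 : ¬ Has2341 f′
    ¬2341 (w , x , y , z , w<x , x<y , y<z , fz<fw , fw<fx , fx<fy)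
      with punchIn-view p w | punchIn-view p x | punchIn-view p y | punchIn-view p z
    ... | inj₁ refl       | _               | _               | _               = ≮f′p fz<fw
    ... | inj₂ _          | inj₁ refl       | _               | _               = ≮f′p fw<fx
    ... | inj₂ _          | inj₂ _          | inj₁ refl       | _               = ≮f′p fx<fy
    ... | inj₂ (a , refl) | inj₂ (b , refl) | inj₂ (c , refl) | inj₁ refl       =
      ¬b2341 (a , b , c , ι-cancel w<x , ι-cancel x<y , low<⇒ c y<z , f′-cancel fw<fx , f′-cancel fx<fy)
    ... | inj₂ (a , refl) | inj₂ (b , refl) | inj₂ (c , refl) | inj₂ (d , refl) =
      ¬h2341 (a , b , c , d , ι-cancel w<x , ι-cancel x<y , ι-cancel y<z ,
        f′-cancel fz<fw , f′-cancel fw<fx , f′-cancel fx<fy)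

    ¬3412 : ¬ Has3412 f′
    ¬3412 (w , x , y , z , w<x , x<y , y<z , fy<fz , fz<fw , fw<fx)
      with punchIn-view p w | punchIn-view p x | punchIn-view p y | punchIn-view p z
    ... | inj₁ refl       | _               | _               | _               = ≮f′p fz<fw
    ... | inj₂ _          | inj₁ refl       | _               | _               = ≮f′p fw<fx
    ... | inj₂ _          | inj₂ _          | _               | inj₁ refl       = ≮f′p fy<fz
    ... | inj₂ (a , refl) | inj₂ (b , refl) | inj₁ refl       | inj₂ (d , refl) =
      ¬b3412 (a , b , d , ι-cancel w<x , low<⇒ b x<y , high≤⇒ d y<z , f′-cancel fz<fw , f′-cancel fw<fx)
    ... | inj₂ (a , refl) | inj₂ (b , refl) | inj₂ (c , refl) | inj₂ (d , refl) =
      ¬h3412 (a , b , c , d , ι-cancel w<x , ι-cancel x<y , ι-cancel y<z ,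
        f′-cancel fy<fz , f′-cancel fz<fw , f′-cancel fw<fx)

-- The generating tree

-- The arguments of a label locate the active sites of a permutation:
--   E j : 0 … j+1          D j : 0 … j+2            B x i : x … x+i+2
--   G j z : 0 … j+1, z     P x z, V x z : x, z      G′ x z : x, z, z+1
--   W x d : x … x+d        Z : 0 (the empty permutation)
-- E j is the decreasing permutation of length j+1, D j starts with j+1 decreasing entries and increases
-- from position j on; the remaining labels have no such short description and are given by their invariants.
data Label : Set where
  Z          : Label
  E D        : ℕ → Label
  B G P V G′ W : ℕ → ℕ → Label

Kid : Set
Kid = ℕ × Label

-- Insertions at consecutive sites s, each killing all sites up to s. The left end of the new label
-- is s+1, and adding its second argument gives x+d for every member of the run.
run : (ℕ → ℕ → Label) → ℕ → ℕ → List Kid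
run g x zero    = []
run g x (suc d) = (x , g (suc x) d) ∷ run g (suc x) d

kids : Label → List Kid
kids Z        = (0 , E 0) ∷ []
kids (E j)    = run B 0 j ++ (j , D j) ∷ (suc j , E (suc j)) ∷ []
kids (D j)    = run B 0 j ++ (j , D j) ∷ (suc j , D (suc j)) ∷ (2 ℕ.+ j , G j (3 ℕ.+ j)) ∷ []
kids (B x i)  = (x , B (suc x) i) ∷ run (λ y d → W y (2 ℕ.+ d)) (suc x) i ++
                (suc (x ℕ.+ i) , G′ x (2 ℕ.+ (x ℕ.+ i))) ∷ (2 ℕ.+ (x ℕ.+ i) , P x (3 ℕ.+ (x ℕ.+ i))) ∷ []
kids (G j z)  = run (λ y d → W y (suc d)) 0 (suc j) ++ (suc j , P (2 ℕ.+ j) (suc z)) ∷ (z , G j (suc z)) ∷ []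
kids (P x z)  = (x , P (suc x) (suc z)) ∷ (z , P x (suc z)) ∷ []
kids (V x z)  = (x , W (suc x) 0) ∷ (z , V x (suc z)) ∷ []
kids (G′ x z) = (x , P (suc x) (suc z)) ∷ (z , G′ x (suc z)) ∷ (suc z , V x (2 ℕ.+ z)) ∷ []
kids (W x d)  = run W x (suc d)

All-run : ∀ {a} {P : Kid → Set a} g x d →
  (∀ s d′ → x ≤ s → suc s ℕ.+ d′ ≡ x ℕ.+ d → P (s , g (suc s) d′)) → All P (run g x d)
All-run g x zero    h = []
All-run g x (suc d) h =
  h x d ≤-refl (sym (ℕ.+-suc x d)) ∷
  All-run g (suc x) d (λ s d′ x<s eq → h s d′ (<⇒≤ x<s) (trans eq (sym (ℕ.+-suc x d))))

∈-run : ∀ g x d {s} → x ≤ s → s < x ℕ.+ d → ∃ λ ℓ → (s , ℓ) ∈ run g x d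
∈-run g x zero    x≤s s<x+0 = contradiction (<-≤-trans s<x+0 (≤-trans (≤-reflexive (ℕ.+-identityʳ x)) x≤s)) (<-irrefl refl)
∈-run g x (suc d) x≤s s<x+d with m≤n⇒m<n∨m≡n x≤s
... | inj₂ refl = _ , here refl
... | inj₁ x<s  with ∈-run g (suc x) d x<s (<-≤-trans s<x+d (≤-reflexive (ℕ.+-suc x d)))
...   | ℓ , s∈ = ℓ , there s∈

SitesIncreaseFrom : ℕ → List Kid → Set
SitesIncreaseFrom lo []             = ⊤
SitesIncreaseFrom lo ((s , _) ∷ ks) = lo ≤ s × SitesIncreaseFrom (suc s) ks

sitesIncrease-run : ∀ g x d {ks} → SitesIncreaseFrom (x ℕ.+ d) ks → SitesIncreaseFrom x (run g x d ++ ks)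
sitesIncrease-run g x zero    {ks} h = subst (λ lo → SitesIncreaseFrom lo ks) (ℕ.+-identityʳ x) h
sitesIncrease-run g x (suc d) {ks} h =
  ≤-refl , sitesIncrease-run g (suc x) d (subst (λ lo → SitesIncreaseFrom lo ks) (ℕ.+-suc x d) h)

sitesIncrease-weaken : ∀ {lo lo′} ks → lo′ ≤ lo → SitesIncreaseFrom lo ks → SitesIncreaseFrom lo′ ks
sitesIncrease-weaken []       _      _            = tt
sitesIncrease-weaken (_ ∷ ks) lo′≤lo (lo≤s , inc) = ≤-trans lo′≤lo lo≤s , inc

-- Invariants of the labels

module _ (Q : Profile) where

  open Profile Q

  record InvZ : Set where
    field
      A⇒   : ∀ {s} → A s → s ≤ 0
      A⇐   : A 0
      inc  : I 0

  record InvE (j : ℕ) : Set where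
    field
      A⇒   : ∀ {s} → A s → s ≤ 1 ℕ.+ j
      A⇐   : ∀ {s} → s ≤ 1 ℕ.+ j → A s
      desc : S 0 (1 ℕ.+ j)
      inc  : I j
      ninc : ∀ {s} → s < j → ¬ I s

  record InvD (j : ℕ) : Set where
    field
      A⇒   : ∀ {s} → A s → s ≤ 2 ℕ.+ j
      A⇐   : ∀ {s} → s ≤ 2 ℕ.+ j → A s
      desc : S 0 (1 ℕ.+ j)
      asc  : ¬ S j (2 ℕ.+ j)
      inc  : I j
      ninc : ∀ {s} → s < j → ¬ I s

  record InvB (x c : ℕ) : Set where
    field
      x≤c  : x ≤ c
      A⇒   : ∀ {s} → A s → x ≤ s × s ≤ 2 ℕ.+ c
      A⇐   : ∀ {s} → x ≤ s → s ≤ 2 ℕ.+ c → A s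
      desc : S 0 x
      asc  : ¬ S 0 (1 ℕ.+ x)
      runs : S x (2 ℕ.+ c)
      inc  : I (1 ℕ.+ c)
      ninc : ¬ I c

  record InvG (j z : ℕ) : Set where
    field
      j<z  : 1 ℕ.+ j < z
      A⇒   : ∀ {s} → A s → s ≤ 1 ℕ.+ j ⊎ s ≡ z
      A⇐   : ∀ {s} → s ≤ 1 ℕ.+ j → A s
      Az   : A z
      desc : S 0 (1 ℕ.+ j)
      runs : S (1 ℕ.+ j) z
      asc  : ¬ S j z
      inc  : I z
      ninc : ¬ I (1 ℕ.+ j)

  -- The common part of `P` and `V`. They differ in whether the entries between the two sites are
  -- decreasing, which decides whether z survives an insertion at x.
  record InvPair (x z : ℕ) : Set where
    field
      x<z  : x < z
      A⇒   : ∀ {s} → A s → s ≡ x ⊎ s ≡ z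
      Ax   : A x
      Az   : A z
      desc : S 0 x
      asc  : ¬ S 0 z
      inc  : I z
      ninc : ¬ I x

  record InvG′ (x z : ℕ) : Set where
    field
      x<z  : x < z
      A⇒   : ∀ {s} → A s → s ≡ x ⊎ s ≡ z ⊎ s ≡ suc z
      Ax   : A x
      Az   : A z
      Az⁺  : A (suc z)
      desc : S 0 x
      asc  : ¬ S 0 z
      runs : S x z
      jump : ¬ S x (suc z)
      inc  : I z
      ninc : ¬ I x

  -- `quiet` is what the origins of `W` share: coming from `B` there is an ascent in front of x,
  -- coming from `G` or `V` the suffix is not increasing. Either way an insertion at any active site
  -- kills all sites up to it.
  record InvW (x e : ℕ) : Set where
    field
      A⇒    : ∀ {s} → A s → x ≤ s × s ≤ e
      A⇐    : ∀ {s} → x ≤ s → s ≤ e → A s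
      runs  : S x e
      quiet : I e → ¬ S 0 x

  -- Counts depend on the lengths i and d, so labels carry these. Insertions shift positions, so the
  -- invariants use the end points x+i and x+d.
  Inv : Label → Set
  Inv Z        = InvZ
  Inv (E j)    = InvE j
  Inv (D j)    = InvD j
  Inv (B x i)  = InvB x (x ℕ.+ i)
  Inv (G j z)  = InvG j z
  Inv (P x z)  = InvPair x z × S x z
  Inv (V x z)  = InvPair x z × ¬ S x z
  Inv (G′ x z) = InvG′ x z
  Inv (W x d)  = InvW x (x ℕ.+ d)

-- Transitions between the invariants

data Split (p : ℕ) : ℕ → Set where
  low  : ∀ {s} → s ≤ p → Split p s
  high : ∀ {t} → p ≤ t → Split p (suc t)

split : ∀ p s → Split p s
split p zero    = low z≤n
split p (suc t) with ≤-<-connex p t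
... | inj₁ p≤t = high p≤t
... | inj₂ t<p = low t<p

module Transitions {Q Q′ : Profile} {p : ℕ} (ins : Inserted Q Q′ p) where

  open Inserted ins
  private
    open module Q = Profile Q using (A; S; I; S-mono; S-short; I-mono; A-bounded)
    module Q′ = Profile Q′

  Z→E : p ≡ 0 → InvZ Q → InvE Q′ 0
  Z→E refl inv = record
    { A⇒   = λ {s} → A′⇒ s
    ; A⇐   = λ {s} → A′⇐ s
    ; desc = S-mid⇐ z≤n (S-short z≤n)
    ; inc  = I-mid⇐ inc
    ; ninc = λ ()
    }
    where
    open InvZ inv
    A′⇒ : ∀ s → Q′.A s → s ≤ 1
    A′⇒ s a with split 0 s
    ... | low s≤0  = ≤-trans s≤0 z≤n
    ... | high 0≤t = s≤s (A⇒ (proj₁ (A-high⇒ 0≤t a)))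
    A′⇐ : ∀ s → s ≤ 1 → Q′.A s
    A′⇐ zero          _ = A-low⇐ z≤n A⇐ (S-short z≤n) inc
    A′⇐ (suc zero)    _ = A-high⇐ z≤n A⇐ (S-short z≤n)
    A′⇐ (suc (suc s)) (s≤s ())

  -- The entries behind p are not increasing, so the sites up to p die; those behind survive because
  -- the whole prefix is decreasing.
  E→B : ∀ {j} → p < j → InvE Q j → InvB Q′ (suc p) j
  E→B {suc j} (s≤s p≤j) inv = record
    { x≤c  = s≤s p≤j
    ; A⇒   = λ {s} → A′⇒ s
    ; A⇐   = λ {s} → A′⇐ s
    ; desc = S-mid⇐ z≤n (S-mono z≤n (≤-trans p≤j (m≤n+m j 2)) desc)
    ; asc  = S-mid✗ z≤n ≤-refl (A-bounded (A⇐ (s≤s (≤-trans p≤j (n≤1+n j)))))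
    ; runs = S-high⇐ ≤-refl (S-mono z≤n ≤-refl desc)
    ; inc  = I-high⇐ (≤-trans p≤j (n≤1+n j)) inc
    ; ninc = λ i → ninc ≤-refl (I-high⇒ p≤j i)
    }
    where
    open InvE inv
    A′⇒ : ∀ s → Q′.A s → suc p ≤ s × s ≤ 3 ℕ.+ j
    A′⇒ s a with split p s
    ... | low s≤p  = contradiction (proj₂ (proj₂ (A-low⇒ s≤p a))) (ninc (s≤s p≤j))
    ... | high p≤t = s≤s p≤t , s≤s (A⇒ (proj₁ (A-high⇒ p≤t a)))
    A′⇐ : ∀ s → suc p ≤ s → s ≤ 3 ℕ.+ j → Q′.A s
    A′⇐ (suc t) (s≤s p≤t) (s≤s t≤2+j) = A-high⇐ p≤t (A⇐ t≤2+j) (S-mono z≤n t≤2+j desc)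

  E→D : ∀ {j} → p ≡ j → InvE Q j → InvD Q′ j
  E→D {j} refl inv = record
    { A⇒   = λ {s} → A′⇒ s
    ; A⇐   = λ {s} → A′⇐ s
    ; desc = S-mid⇐ z≤n (S-mono z≤n (n≤1+n j) desc)
    ; asc  = S-mid✗ ≤-refl ≤-refl (A-bounded (A⇐ ≤-refl))
    ; inc  = I-mid⇐ inc
    ; ninc = I-low✗
    }
    where
    open InvE inv
    A′⇒ : ∀ s → Q′.A s → s ≤ 2 ℕ.+ j
    A′⇒ s a with split p s
    ... | low s≤p  = ≤-trans s≤p (m≤n+m j 2)
    ... | high p≤t = s≤s (A⇒ (proj₁ (A-high⇒ p≤t a)))
    A′⇐ : ∀ s → s ≤ 2 ℕ.+ j → Q′.A s
    A′⇐ s s≤2+j with split p s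
    ... | low s≤p = A-low⇐ s≤p (A⇐ s≤1+j) (S-mono z≤n s≤1+j desc) inc
      where s≤1+j = ≤-trans s≤p (n≤1+n j)
    A′⇐ (suc t) (s≤s t≤1+j) | high p≤t = A-high⇐ p≤t (A⇐ t≤1+j) (S-short t≤1+j)

  E→E : ∀ {j} → p ≡ suc j → InvE Q j → InvE Q′ (suc j)
  E→E {j} refl inv = record
    { A⇒   = λ {s} → A′⇒ s
    ; A⇐   = λ {s} → A′⇐ s
    ; desc = S-mid⇐ z≤n desc
    ; inc  = I-mid⇐ (I-mono (n≤1+n j) inc)
    ; ninc = I-low✗
    }
    where
    open InvE inv
    A′⇒ : ∀ s → Q′.A s → s ≤ 2 ℕ.+ j
    A′⇒ s a with split p s
    ... | low s≤p  = ≤-trans s≤p (n≤1+n _)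
    ... | high p≤t = s≤s (A⇒ (proj₁ (A-high⇒ p≤t a)))
    A′⇐ : ∀ s → s ≤ 2 ℕ.+ j → Q′.A s
    A′⇐ s s≤2+j with split p s
    ... | low s≤p = A-low⇐ s≤p (A⇐ s≤p) (S-mono z≤n s≤p desc) (I-mono (n≤1+n j) inc)
    A′⇐ (suc t) (s≤s t≤1+j) | high p≤t = A-high⇐ p≤t (A⇐ t≤1+j) (S-short (≤-trans t≤1+j (n≤1+n _)))

  D→B : ∀ {j} → p < j → InvD Q j → InvB Q′ (suc p) j
  D→B {suc j} (s≤s p≤j) inv = record
    { x≤c  = s≤s p≤j
    ; A⇒   = λ {s} → A′⇒ s
    ; A⇐   = λ {s} → A′⇐ s
    ; desc = S-mid⇐ z≤n (S-mono z≤n (≤-trans p≤j (m≤n+m j 2)) desc)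
    ; asc  = S-mid✗ z≤n ≤-refl (A-bounded (A⇐ (s≤s (≤-trans p≤j (m≤n+m j 2)))))
    ; runs = S-high⇐ ≤-refl (S-mono z≤n ≤-refl desc)
    ; inc  = I-high⇐ (≤-trans p≤j (n≤1+n j)) inc
    ; ninc = λ i → ninc ≤-refl (I-high⇒ p≤j i)
    }
    where
    open InvD inv
    A′⇒ : ∀ s → Q′.A s → suc p ≤ s × s ≤ 3 ℕ.+ j
    A′⇒ s a with split p s
    ... | low s≤p  = contradiction (proj₂ (proj₂ (A-low⇒ s≤p a))) (ninc (s≤s p≤j))
    ... | high p≤t with A-high⇒ p≤t a
    ...   | At , Spt with m≤n⇒m<n∨m≡n (A⇒ At)
    ...     | inj₁ (s≤s t≤2+j) = s≤s p≤t , s≤s t≤2+j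
    ...     | inj₂ refl        = contradiction (S-mono (≤-trans p≤j (n≤1+n j)) ≤-refl Spt) asc
    A′⇐ : ∀ s → suc p ≤ s → s ≤ 3 ℕ.+ j → Q′.A s
    A′⇐ (suc t) (s≤s p≤t) (s≤s t≤2+j) = A-high⇐ p≤t (A⇐ (≤-trans t≤2+j (n≤1+n _))) (S-mono z≤n t≤2+j desc)

  D→D : ∀ {j} → p ≡ j → InvD Q j → InvD Q′ j
  D→D {j} refl inv = record
    { A⇒   = λ {s} → A′⇒ s
    ; A⇐   = λ {s} → A′⇐ s
    ; desc = S-mid⇐ z≤n (S-mono z≤n (n≤1+n j) desc)
    ; asc  = S-mid✗ ≤-refl ≤-refl (A-bounded (A⇐ (n≤1+n _)))
    ; inc  = I-mid⇐ inc
    ; ninc = I-low✗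
    }
    where
    open InvD inv
    A′⇒ : ∀ s → Q′.A s → s ≤ 2 ℕ.+ j
    A′⇒ s a with split p s
    ... | low s≤p  = ≤-trans s≤p (m≤n+m j 2)
    ... | high p≤t with A-high⇒ p≤t a
    ...   | At , Spt with m≤n⇒m<n∨m≡n (A⇒ At)
    ...     | inj₁ t<2+j = t<2+j
    ...     | inj₂ refl  = contradiction Spt asc
    A′⇐ : ∀ s → s ≤ 2 ℕ.+ j → Q′.A s
    A′⇐ s s≤2+j with split p s
    ... | low s≤p = A-low⇐ s≤p (A⇐ s≤2+j) (S-mono z≤n (≤-trans s≤p (n≤1+n j)) desc) inc
    A′⇐ (suc t) (s≤s t≤1+j) | high p≤t = A-high⇐ p≤t (A⇐ (≤-trans t≤1+j (n≤1+n _))) (S-short t≤1+j)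

  D→D⁺ : ∀ {j} → p ≡ suc j → InvD Q j → InvD Q′ (suc j)
  D→D⁺ {j} refl inv = record
    { A⇒   = λ {s} → A′⇒ s
    ; A⇐   = λ {s} → A′⇐ s
    ; desc = S-mid⇐ z≤n desc
    ; asc  = S-mid✗ ≤-refl ≤-refl (A-bounded (A⇐ ≤-refl))
    ; inc  = I-mid⇐ (I-mono (n≤1+n j) inc)
    ; ninc = I-low✗
    }
    where
    open InvD inv
    A′⇒ : ∀ s → Q′.A s → s ≤ 3 ℕ.+ j
    A′⇒ s a with split p s
    ... | low s≤p  = ≤-trans s≤p (m≤n+m _ 2)
    ... | high p≤t = s≤s (A⇒ (proj₁ (A-high⇒ p≤t a)))
    A′⇐ : ∀ s → s ≤ 3 ℕ.+ j → Q′.A s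
    A′⇐ s s≤3+j with split p s
    ... | low s≤p = A-low⇐ s≤p (A⇐ (≤-trans s≤p (n≤1+n _))) (S-mono z≤n s≤p desc) (I-mono (n≤1+n j) inc)
    A′⇐ (suc t) (s≤s t≤2+j) | high p≤t = A-high⇐ p≤t (A⇐ t≤2+j) (S-short t≤2+j)

  -- The suffix behind p is increasing, so exactly the sites with a decreasing prefix survive on the
  -- left. The site directly in front of the minimum is not among them, which opens the gap before
  -- z.
  D→G : ∀ {j} → p ≡ 2 ℕ.+ j → InvD Q j → InvG Q′ j (3 ℕ.+ j)
  D→G {j} refl inv = record
    { j<z  = n≤1+n _
    ; A⇒   = λ {s} → A′⇒ s
    ; A⇐   = λ s≤1+j → A-low⇐ (≤-trans s≤1+j (n≤1+n _)) (A⇐ (≤-trans s≤1+j (n≤1+n _))) (S-mono z≤n s≤1+j desc) inc′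
    ; Az   = A-high⇐ ≤-refl (A⇐ ≤-refl) (S-short (n≤1+n _))
    ; desc = S-low⇐ (n≤1+n _) desc
    ; runs = S-mid⇐ (n≤1+n _) (S-short ≤-refl)
    ; asc  = λ d → asc (S-mid⇒ (m≤n+m j 2) d)
    ; inc  = I-high⇐ ≤-refl inc′
    ; ninc = I-low✗ ≤-refl
    }
    where
    open InvD inv
    inc′ : I (2 ℕ.+ j)
    inc′ = I-mono (m≤n+m j 2) inc
    A′⇒ : ∀ s → Q′.A s → s ≤ 1 ℕ.+ j ⊎ s ≡ 3 ℕ.+ j
    A′⇒ s a with split p s
    ... | high p≤t = inj₂ (cong suc (≤-antisym (A⇒ (proj₁ (A-high⇒ p≤t a))) p≤t))
    ... | low s≤p with m≤n⇒m<n∨m≡n s≤p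
    ...   | inj₁ (s≤s s≤1+j) = inj₁ s≤1+j
    ...   | inj₂ refl        = contradiction (S-mono z≤n ≤-refl (proj₁ (proj₂ (A-low⇒ s≤p a)))) asc

  B→B : ∀ {x c} → p ≡ x → InvB Q x c → InvB Q′ (suc x) (suc c)
  B→B {x} {c} refl inv = record
    { x≤c  = s≤s x≤c
    ; A⇒   = λ {s} → A′⇒ s
    ; A⇐   = λ {s} → A′⇐ s
    ; desc = S-mid⇐ z≤n desc
    ; asc  = S-mid✗ z≤n ≤-refl (A-bounded (A⇐ (n≤1+n x) (s≤s (≤-trans x≤c (n≤1+n c)))))
    ; runs = S-high⇐ ≤-refl runs
    ; inc  = I-high⇐ (≤-trans x≤c (n≤1+n c)) inc
    ; ninc = λ i → ninc (I-high⇒ x≤c i)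
    }
    where
    open InvB inv
    A′⇒ : ∀ s → Q′.A s → suc x ≤ s × s ≤ 3 ℕ.+ c
    A′⇒ s a with split p s
    ... | low s≤p  = contradiction (I-mono x≤c (proj₂ (proj₂ (A-low⇒ s≤p a)))) ninc
    ... | high p≤t = s≤s p≤t , s≤s (proj₂ (A⇒ (proj₁ (A-high⇒ p≤t a))))
    A′⇐ : ∀ s → suc x ≤ s → s ≤ 3 ℕ.+ c → Q′.A s
    A′⇐ (suc t) (s≤s p≤t) (s≤s t≤2+c) = A-high⇐ p≤t (A⇐ p≤t t≤2+c) (S-mono ≤-refl t≤2+c runs)

  B→W : ∀ {x c} → x < p → p ≤ c → InvB Q x c → InvW Q′ (suc p) (3 ℕ.+ c)
  B→W {x} {c} x<p p≤c inv = record
    { A⇒    = λ {s} → A′⇒ s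
    ; A⇐    = λ {s} → A′⇐ s
    ; runs  = S-high⇐ ≤-refl (S-mono (<⇒≤ x<p) ≤-refl runs)
    ; quiet = λ _ d → asc (S-mono z≤n x<p (S-mid⇒ z≤n d))
    }
    where
    open InvB inv
    A′⇒ : ∀ s → Q′.A s → suc p ≤ s × s ≤ 3 ℕ.+ c
    A′⇒ s a with split p s
    ... | low s≤p  = contradiction (I-mono p≤c (proj₂ (proj₂ (A-low⇒ s≤p a)))) ninc
    ... | high p≤t = s≤s p≤t , s≤s (proj₂ (A⇒ (proj₁ (A-high⇒ p≤t a))))
    A′⇐ : ∀ s → suc p ≤ s → s ≤ 3 ℕ.+ c → Q′.A s
    A′⇐ (suc t) (s≤s p≤t) (s≤s t≤2+c) =
      A-high⇐ p≤t (A⇐ (≤-trans (<⇒≤ x<p) p≤t) t≤2+c) (S-mono (<⇒≤ x<p) t≤2+c runs)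

  -- At c+1 the suffix becomes increasing, so x survives on the left; the other active sites up to p
  -- die because of the ascent that ends at position x.
  B→G′ : ∀ {x c} → p ≡ suc c → InvB Q x c → InvG′ Q′ x (2 ℕ.+ c)
  B→G′ {x} {c} refl inv = record
    { x<z  = s≤s x≤1+c
    ; A⇒   = λ {s} → A′⇒ s
    ; Ax   = A-low⇐ x≤1+c (A⇐ ≤-refl x≤2+c) desc inc
    ; Az   = A-high⇐ ≤-refl (A⇐ x≤1+c (n≤1+n _)) (S-short (n≤1+n _))
    ; Az⁺  = A-high⇐ (n≤1+n _) (A⇐ x≤2+c ≤-refl) (S-short ≤-refl)
    ; desc = S-low⇐ x≤1+c desc
    ; asc  = λ d → asc (S-mono z≤n (s≤s x≤c) (S-mid⇒ z≤n d))
    ; runs = S-mid⇐ x≤1+c (S-mono ≤-refl (n≤1+n _) runs)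
    ; jump = S-mid✗ x≤1+c ≤-refl (A-bounded (A⇐ x≤2+c ≤-refl))
    ; inc  = I-high⇐ ≤-refl inc
    ; ninc = I-low✗ (s≤s x≤c)
    }
    where
    open InvB inv
    x≤1+c : x ≤ 1 ℕ.+ c
    x≤1+c = ≤-trans x≤c (n≤1+n c)
    x≤2+c : x ≤ 2 ℕ.+ c
    x≤2+c = ≤-trans x≤c (m≤n+m c 2)
    A′⇒ : ∀ s → Q′.A s → s ≡ x ⊎ s ≡ 2 ℕ.+ c ⊎ s ≡ 3 ℕ.+ c
    A′⇒ s a with split p s
    ... | low s≤p with A-low⇒ s≤p a
    ...   | As , S0s , _ with m≤n⇒m<n∨m≡n (proj₁ (A⇒ As))
    ...     | inj₁ x<s  = contradiction (S-mono z≤n x<s S0s) asc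
    ...     | inj₂ refl = inj₁ refl
    A′⇒ s a | high p≤t with m≤n⇒m<n∨m≡n p≤t
    ...   | inj₂ refl = inj₂ (inj₁ refl)
    ...   | inj₁ p<t  = inj₂ (inj₂ (cong suc (≤-antisym (proj₂ (A⇒ (proj₁ (A-high⇒ p≤t a)))) p<t)))

  B→P : ∀ {x c} → p ≡ 2 ℕ.+ c → InvB Q x c → InvPair Q′ x (3 ℕ.+ c) × Q′.S x (3 ℕ.+ c)
  B→P {x} {c} refl inv = record
    { x<z  = s≤s x≤2+c
    ; A⇒   = λ {s} → A′⇒ s
    ; Ax   = A-low⇐ x≤2+c (A⇐ ≤-refl x≤2+c) desc inc′
    ; Az   = A-high⇐ ≤-refl (A⇐ x≤2+c ≤-refl) (S-short (n≤1+n _))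
    ; desc = S-low⇐ x≤2+c desc
    ; asc  = λ d → asc (S-mono z≤n (s≤s (≤-trans x≤c (n≤1+n c))) (S-mid⇒ z≤n d))
    ; inc  = I-high⇐ ≤-refl inc′
    ; ninc = I-low✗ (s≤s (≤-trans x≤c (n≤1+n c)))
    } , S-mid⇐ x≤2+c runs
    where
    open InvB inv
    x≤2+c : x ≤ 2 ℕ.+ c
    x≤2+c = ≤-trans x≤c (m≤n+m c 2)
    inc′ : I (2 ℕ.+ c)
    inc′ = I-mono (n≤1+n _) inc
    A′⇒ : ∀ s → Q′.A s → s ≡ x ⊎ s ≡ 3 ℕ.+ c
    A′⇒ s a with split p s
    ... | low s≤p with A-low⇒ s≤p a
    ...   | As , S0s , _ with m≤n⇒m<n∨m≡n (proj₁ (A⇒ As))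
    ...     | inj₁ x<s  = contradiction (S-mono z≤n x<s S0s) asc
    ...     | inj₂ refl = inj₁ refl
    A′⇒ s a | high p≤t = inj₂ (cong suc (≤-antisym (proj₂ (A⇒ (proj₁ (A-high⇒ p≤t a)))) p≤t))

  G→W : ∀ {j z} → p ≤ j → InvG Q j z → InvW Q′ (suc p) (2 ℕ.+ j)
  G→W {j} {z} p≤j inv = record
    { A⇒    = λ {s} → A′⇒ s
    ; A⇐    = λ {s} → A′⇐ s
    ; runs  = S-high⇐ ≤-refl (S-mono z≤n ≤-refl desc)
    ; quiet = λ i _ → ninc (I-high⇒ p≤1+j i)
    }
    where
    open InvG inv
    p≤1+j : p ≤ 1 ℕ.+ j
    p≤1+j = ≤-trans p≤j (n≤1+n j)
    A′⇒ : ∀ s → Q′.A s → suc p ≤ s × s ≤ 2 ℕ.+ j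
    A′⇒ s a with split p s
    ... | low s≤p  = contradiction (I-mono p≤1+j (proj₂ (proj₂ (A-low⇒ s≤p a)))) ninc
    ... | high p≤t with A-high⇒ p≤t a
    ...   | At , Spt with A⇒ At
    ...     | inj₁ t≤1+j = s≤s p≤t , s≤s t≤1+j
    ...     | inj₂ refl  = contradiction (S-mono p≤j ≤-refl Spt) asc
    A′⇐ : ∀ s → suc p ≤ s → s ≤ 2 ℕ.+ j → Q′.A s
    A′⇐ (suc t) (s≤s p≤t) (s≤s t≤1+j) = A-high⇐ p≤t (A⇐ t≤1+j) (S-mono z≤n t≤1+j desc)

  G→P : ∀ {j z} → p ≡ suc j → InvG Q j z → InvPair Q′ (2 ℕ.+ j) (suc z) × Q′.S (2 ℕ.+ j) (suc z)
  G→P {j} {z} refl inv = record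
    { x<z  = s≤s j<z
    ; A⇒   = λ {s} → A′⇒ s
    ; Ax   = A-high⇐ ≤-refl (A⇐ ≤-refl) (S-short (n≤1+n _))
    ; Az   = A-high⇐ (<⇒≤ j<z) Az runs
    ; desc = S-mid⇐ z≤n desc
    ; asc  = S-mid✗ z≤n j<z (A-bounded Az)
    ; inc  = I-high⇐ (<⇒≤ j<z) inc
    ; ninc = λ i → ninc (I-high⇒ ≤-refl i)
    } , S-high⇐ ≤-refl runs
    where
    open InvG inv
    A′⇒ : ∀ s → Q′.A s → s ≡ 2 ℕ.+ j ⊎ s ≡ suc z
    A′⇒ s a with split p s
    ... | low s≤p  = contradiction (proj₂ (proj₂ (A-low⇒ s≤p a))) ninc
    ... | high p≤t with A⇒ (proj₁ (A-high⇒ p≤t a))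
    ...   | inj₁ t≤1+j = inj₁ (cong suc (≤-antisym t≤1+j p≤t))
    ...   | inj₂ refl  = inj₂ refl

  G→G : ∀ {j z} → p ≡ z → InvG Q j z → InvG Q′ j (suc z)
  G→G {j} {z} refl inv = record
    { j<z  = ≤-trans j<z (n≤1+n _)
    ; A⇒   = λ {s} → A′⇒ s
    ; A⇐   = λ s≤1+j → A-low⇐ (≤-trans s≤1+j (<⇒≤ j<z)) (A⇐ s≤1+j) (S-mono z≤n s≤1+j desc) inc
    ; Az   = A-high⇐ ≤-refl Az (S-short (n≤1+n _))
    ; desc = S-low⇐ (<⇒≤ j<z) desc
    ; runs = S-mid⇐ (<⇒≤ j<z) runs
    ; asc  = λ d → asc (S-mid⇒ (≤-trans (n≤1+n j) (<⇒≤ j<z)) d)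
    ; inc  = I-high⇐ ≤-refl inc
    ; ninc = I-low✗ j<z
    }
    where
    open InvG inv
    A′⇒ : ∀ s → Q′.A s → s ≤ 1 ℕ.+ j ⊎ s ≡ suc z
    A′⇒ s a with split p s
    ... | low s≤p with A-low⇒ s≤p a
    ...   | As , S0s , _ with A⇒ As
    ...     | inj₁ s≤1+j = inj₁ s≤1+j
    ...     | inj₂ refl  = contradiction (S-mono z≤n ≤-refl S0s) asc
    A′⇒ s a | high p≤t with A⇒ (proj₁ (A-high⇒ p≤t a))
    ...   | inj₁ t≤1+j = contradiction (<-≤-trans j<z (≤-trans p≤t t≤1+j)) (<-irrefl refl)
    ...   | inj₂ refl  = inj₂ refl

  P→P : ∀ {x z} → p ≡ x → InvPair Q x z × S x z → InvPair Q′ (suc x) (suc z) × Q′.S (suc x) (suc z)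
  P→P {x} {z} refl (inv , runs) = record
    { x<z  = s≤s x<z
    ; A⇒   = λ {s} → A′⇒ s
    ; Ax   = A-high⇐ ≤-refl Ax (S-short (n≤1+n _))
    ; Az   = A-high⇐ (<⇒≤ x<z) Az runs
    ; desc = S-mid⇐ z≤n desc
    ; asc  = S-mid✗ z≤n x<z (A-bounded Az)
    ; inc  = I-high⇐ (<⇒≤ x<z) inc
    ; ninc = λ i → ninc (I-high⇒ ≤-refl i)
    } , S-high⇐ ≤-refl runs
    where
    open InvPair inv
    A′⇒ : ∀ s → Q′.A s → s ≡ suc x ⊎ s ≡ suc z
    A′⇒ s a with split p s
    ... | low s≤p  = contradiction (proj₂ (proj₂ (A-low⇒ s≤p a))) ninc
    ... | high p≤t with A⇒ (proj₁ (A-high⇒ p≤t a))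
    ...   | inj₁ refl = inj₁ refl
    ...   | inj₂ refl = inj₂ refl

  -- An insertion at z does not depend on the entries between x and z, hence one proof for `P` and
  -- `V`.
  Pair→Pair : ∀ {x z} → p ≡ z → InvPair Q x z → InvPair Q′ x (suc z)
  Pair→Pair {x} {z} refl inv = record
    { x<z  = ≤-trans x<z (n≤1+n _)
    ; A⇒   = λ {s} → A′⇒ s
    ; Ax   = A-low⇐ (<⇒≤ x<z) Ax desc inc
    ; Az   = A-high⇐ ≤-refl Az (S-short (n≤1+n _))
    ; desc = S-low⇐ (<⇒≤ x<z) desc
    ; asc  = λ d → asc (S-mid⇒ z≤n d)
    ; inc  = I-high⇐ ≤-refl inc
    ; ninc = I-low✗ x<z
    }
    where
    open InvPair inv
    A′⇒ : ∀ s → Q′.A s → s ≡ x ⊎ s ≡ suc z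
    A′⇒ s a with split p s
    ... | low s≤p with A-low⇒ s≤p a
    ...   | As , S0s , _ with A⇒ As
    ...     | inj₁ refl = inj₁ refl
    ...     | inj₂ refl = contradiction S0s asc
    A′⇒ s a | high p≤t with A⇒ (proj₁ (A-high⇒ p≤t a))
    ...   | inj₁ refl = contradiction (<-≤-trans x<z p≤t) (<-irrefl refl)
    ...   | inj₂ refl = inj₂ refl

  P→P⁺ : ∀ {x z} → p ≡ z → InvPair Q x z × S x z → InvPair Q′ x (suc z) × Q′.S x (suc z)
  P→P⁺ refl (inv , runs) = Pair→Pair refl inv , S-mid⇐ (<⇒≤ (InvPair.x<z inv)) runs

  V→V : ∀ {x z} → p ≡ z → InvPair Q x z × ¬ S x z → InvPair Q′ x (suc z) × ¬ Q′.S x (suc z)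
  V→V refl (inv , ¬runs) = Pair→Pair refl inv , λ d → ¬runs (S-mid⇒ (<⇒≤ (InvPair.x<z inv)) d)

  -- The ascent between x and z kills z, and x itself dies for want of an increasing suffix; only
  -- the site behind the minimum remains.
  V→W : ∀ {x z} → p ≡ x → InvPair Q x z × ¬ S x z → InvW Q′ (suc x) (suc x)
  V→W {x} {z} refl (inv , ¬runs) = record
    { A⇒    = λ {s} → A′⇒ s
    ; A⇐    = λ x<s s≤1+x → subst Q′.A (≤-antisym x<s s≤1+x) (A-high⇐ ≤-refl Ax (S-short (n≤1+n _)))
    ; runs  = Profile.S-short Q′ (n≤1+n _)
    ; quiet = λ i _ → ninc (I-high⇒ ≤-refl i)
    }
    where
    open InvPair inv
    A′⇒ : ∀ s → Q′.A s → suc x ≤ s × s ≤ suc x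
    A′⇒ s a with split p s
    ... | low s≤p  = contradiction (proj₂ (proj₂ (A-low⇒ s≤p a))) ninc
    ... | high p≤t with A-high⇒ p≤t a
    ...   | At , Spt with A⇒ At
    ...     | inj₁ refl = ≤-refl , ≤-refl
    ...     | inj₂ refl = contradiction Spt ¬runs

  G′→P : ∀ {x z} → p ≡ x → InvG′ Q x z → InvPair Q′ (suc x) (suc z) × Q′.S (suc x) (suc z)
  G′→P {x} {z} refl inv = record
    { x<z  = s≤s x<z
    ; A⇒   = λ {s} → A′⇒ s
    ; Ax   = A-high⇐ ≤-refl Ax (S-short (n≤1+n _))
    ; Az   = A-high⇐ (<⇒≤ x<z) Az runs
    ; desc = S-mid⇐ z≤n desc
    ; asc  = S-mid✗ z≤n x<z (A-bounded Az)
    ; inc  = I-high⇐ (<⇒≤ x<z) inc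
    ; ninc = λ i → ninc (I-high⇒ ≤-refl i)
    } , S-high⇐ ≤-refl runs
    where
    open InvG′ inv
    A′⇒ : ∀ s → Q′.A s → s ≡ suc x ⊎ s ≡ suc z
    A′⇒ s a with split p s
    ... | low s≤p  = contradiction (proj₂ (proj₂ (A-low⇒ s≤p a))) ninc
    ... | high p≤t with A-high⇒ p≤t a
    ...   | At , Spt with A⇒ At
    ...     | inj₁ refl        = inj₁ refl
    ...     | inj₂ (inj₁ refl) = inj₂ refl
    ...     | inj₂ (inj₂ refl) = contradiction Spt jump

  G′→G′ : ∀ {x z} → p ≡ z → InvG′ Q x z → InvG′ Q′ x (suc z)
  G′→G′ {x} {z} refl inv = record
    { x<z  = ≤-trans x<z (n≤1+n _)
    ; A⇒   = λ {s} → A′⇒ s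
    ; Ax   = A-low⇐ (<⇒≤ x<z) Ax desc inc
    ; Az   = A-high⇐ ≤-refl Az (S-short (n≤1+n _))
    ; Az⁺  = A-high⇐ (n≤1+n _) Az⁺ (S-short ≤-refl)
    ; desc = S-low⇐ (<⇒≤ x<z) desc
    ; asc  = λ d → asc (S-mid⇒ z≤n d)
    ; runs = S-mid⇐ (<⇒≤ x<z) runs
    ; jump = S-mid✗ (<⇒≤ x<z) ≤-refl (A-bounded Az⁺)
    ; inc  = I-high⇐ ≤-refl inc
    ; ninc = I-low✗ x<z
    }
    where
    open InvG′ inv
    A′⇒ : ∀ s → Q′.A s → s ≡ x ⊎ s ≡ suc z ⊎ s ≡ 2 ℕ.+ z
    A′⇒ s a with split p s
    ... | low s≤p with A-low⇒ s≤p a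
    ...   | As , S0s , _ with A⇒ As
    ...     | inj₁ refl        = inj₁ refl
    ...     | inj₂ (inj₁ refl) = contradiction S0s asc
    ...     | inj₂ (inj₂ refl) = contradiction s≤p 1+n≰n
    A′⇒ s a | high p≤t with A⇒ (proj₁ (A-high⇒ p≤t a))
    ...   | inj₁ refl        = contradiction (<-≤-trans x<z p≤t) (<-irrefl refl)
    ...   | inj₂ (inj₁ refl) = inj₂ (inj₁ refl)
    ...   | inj₂ (inj₂ refl) = inj₂ (inj₂ refl)

  G′→V : ∀ {x z} → p ≡ suc z → InvG′ Q x z → InvPair Q′ x (2 ℕ.+ z) × ¬ Q′.S x (2 ℕ.+ z)
  G′→V {x} {z} refl inv = record
    { x<z  = s≤s x≤1+z
    ; A⇒   = λ {s} → A′⇒ s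
    ; Ax   = A-low⇐ x≤1+z Ax desc (I-mono (n≤1+n z) inc)
    ; Az   = A-high⇐ ≤-refl Az⁺ (S-short (n≤1+n _))
    ; desc = S-low⇐ x≤1+z desc
    ; asc  = λ d → asc (S-mono z≤n (n≤1+n z) (S-mid⇒ z≤n d))
    ; inc  = I-high⇐ ≤-refl (I-mono (n≤1+n z) inc)
    ; ninc = I-low✗ (s≤s (<⇒≤ x<z))
    } , λ d → jump (S-mid⇒ x≤1+z d)
    where
    open InvG′ inv
    x≤1+z : x ≤ suc z
    x≤1+z = ≤-trans (<⇒≤ x<z) (n≤1+n z)
    A′⇒ : ∀ s → Q′.A s → s ≡ x ⊎ s ≡ 2 ℕ.+ z
    A′⇒ s a with split p s
    ... | low s≤p with A-low⇒ s≤p a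
    ...   | As , S0s , _ with A⇒ As
    ...     | inj₁ refl        = inj₁ refl
    ...     | inj₂ (inj₁ refl) = contradiction S0s asc
    ...     | inj₂ (inj₂ refl) = contradiction (S-mono z≤n (n≤1+n z) S0s) asc
    A′⇒ s a | high p≤t with A⇒ (proj₁ (A-high⇒ p≤t a))
    ...   | inj₁ refl        = contradiction (<-≤-trans x<z (≤-trans (n≤1+n z) p≤t)) (<-irrefl refl)
    ...   | inj₂ (inj₁ refl) = contradiction p≤t 1+n≰n
    ...   | inj₂ (inj₂ refl) = inj₂ refl

  W→W : ∀ {x e} → x ≤ p → p ≤ e → InvW Q x e → InvW Q′ (suc p) (suc e)
  W→W {x} {e} x≤p p≤e inv = record
    { A⇒    = λ {s} → A′⇒ s
    ; A⇐    = λ {s} → A′⇐ s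
    ; runs  = S-high⇐ ≤-refl (S-mono x≤p ≤-refl runs)
    ; quiet = λ i d → quiet (I-high⇒ p≤e i) (S-mono z≤n x≤p (S-mid⇒ z≤n d))
    }
    where
    open InvW inv
    A′⇒ : ∀ s → Q′.A s → suc p ≤ s × s ≤ suc e
    A′⇒ s a with split p s
    ... | low s≤p with A-low⇒ s≤p a
    ...   | As , S0s , Ip = contradiction (S-mono z≤n (proj₁ (A⇒ As)) S0s) (quiet (I-mono p≤e Ip))
    A′⇒ s a | high p≤t = s≤s p≤t , s≤s (proj₂ (A⇒ (proj₁ (A-high⇒ p≤t a))))
    A′⇐ : ∀ s → suc p ≤ s → s ≤ suc e → Q′.A s
    A′⇐ (suc t) (s≤s p≤t) (s≤s t≤e) = A-high⇐ p≤t (A⇐ (≤-trans x≤p p≤t) t≤e) (S-mono x≤p t≤e runs)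

-- The children of a label are exactly the active sites

module _ (Q : Profile) where

  open Profile Q

  -- `Inserted` does not determine the new profile, so the label has to fit every profile related by
  -- it.
  Realises : Kid → Set₁
  Realises (s , ℓ) = A s × (∀ {Q′} → Inserted Q Q′ s → Inv Q′ ℓ)

module _ {Q : Profile} where

  open Profile Q using (A)
  open Transitions

  private
    bound : ∀ {s d e} → suc s ℕ.+ d ≡ e → s < e
    bound {s} {d} refl = s≤s (m≤m+n s d)

  kids-realised : ∀ ℓ → Inv Q ℓ → All (Realises Q) (kids ℓ)
  kids-realised Z inv = (A⇐ , λ ins → Z→E ins refl inv) ∷ []
    where open InvZ inv
  kids-realised (E j) inv = All.++⁺
    (All-run B 0 j λ s d _ eq →
      A⇐ (≤-trans (<⇒≤ (bound eq)) (n≤1+n j)) ,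
      λ {Q′} ins → subst (InvB Q′ (suc s)) (sym eq) (E→B ins (bound eq) inv))
    ((A⇐ (n≤1+n j) , λ ins → E→D ins refl inv) ∷ (A⇐ ≤-refl , λ ins → E→E ins refl inv) ∷ [])
    where open InvE inv
  kids-realised (D j) inv = All.++⁺
    (All-run B 0 j λ s d _ eq →
      A⇐ (≤-trans (<⇒≤ (bound eq)) (m≤n+m j 2)) ,
      λ {Q′} ins → subst (InvB Q′ (suc s)) (sym eq) (D→B ins (bound eq) inv))
    ((A⇐ (m≤n+m j 2) , λ ins → D→D ins refl inv) ∷ (A⇐ (n≤1+n _) , λ ins → D→D⁺ ins refl inv) ∷
     (A⇐ ≤-refl , λ ins → D→G ins refl inv) ∷ [])
    where open InvD inv
  kids-realised (B x i) inv =
    (A⇐ ≤-refl (≤-trans x≤c (m≤n+m _ 2)) , λ ins → B→B ins refl inv) ∷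
    All.++⁺
      (All-run (λ y d → W y (2 ℕ.+ d)) (suc x) i λ s d x<s eq →
        A⇐ (<⇒≤ x<s) (≤-trans (s≤s⁻¹ (bound eq)) (m≤n+m _ 2)) ,
        λ {Q′} ins → subst (InvW Q′ (suc s)) (end eq) (B→W ins x<s (s≤s⁻¹ (bound eq)) inv))
      ((A⇐ (≤-trans x≤c (n≤1+n _)) (n≤1+n _) , λ ins → B→G′ ins refl inv) ∷
       (A⇐ (≤-trans x≤c (m≤n+m _ 2)) ≤-refl , λ ins → B→P ins refl inv) ∷ [])
    where
    open InvB inv
    end : ∀ {s d} → suc s ℕ.+ d ≡ suc (x ℕ.+ i) → 3 ℕ.+ (x ℕ.+ i) ≡ suc s ℕ.+ (2 ℕ.+ d)
    end {s} {d} eq rewrite ℕ.+-suc s (suc d) | ℕ.+-suc s d = cong (2 ℕ.+_) (sym eq)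
  kids-realised (G j z) inv = All.++⁺
    (All-run (λ y d → W y (suc d)) 0 (suc j) λ s d _ eq →
      A⇐ (<⇒≤ (bound eq)) ,
      λ {Q′} ins → subst (InvW Q′ (suc s)) (trans (cong suc (sym eq)) (sym (ℕ.+-suc (suc s) d)))
        (G→W ins (s≤s⁻¹ (bound eq)) inv))
    ((A⇐ ≤-refl , λ ins → G→P ins refl inv) ∷ (Az , λ ins → G→G ins refl inv) ∷ [])
    where open InvG inv
  kids-realised (P x z) inv@(pair , _) =
    (Ax , λ ins → P→P ins refl inv) ∷ (Az , λ ins → P→P⁺ ins refl inv) ∷ []
    where open InvPair pair
  kids-realised (V x z) inv@(pair , _) =
    (Ax , λ {Q′} ins → subst (InvW Q′ (suc x)) (sym (ℕ.+-identityʳ (suc x))) (V→W ins refl inv)) ∷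
    (Az , λ ins → V→V ins refl inv) ∷ []
    where open InvPair pair
  kids-realised (G′ x z) inv =
    (Ax , λ ins → G′→P ins refl inv) ∷ (Az , λ ins → G′→G′ ins refl inv) ∷
    (Az⁺ , λ ins → G′→V ins refl inv) ∷ []
    where open InvG′ inv
  kids-realised (W x d) inv = All-run W x (suc d) λ s d′ x≤s eq →
    A⇐ x≤s (≤-end eq) ,
    λ {Q′} ins → subst (InvW Q′ (suc s)) (trans (sym (ℕ.+-suc x d)) (sym eq)) (W→W ins x≤s (≤-end eq) inv)
    where
    open InvW inv
    ≤-end : ∀ {s d′} → suc s ℕ.+ d′ ≡ x ℕ.+ suc d → s ≤ x ℕ.+ d
    ≤-end eq = s≤s⁻¹ (≤-trans (bound eq) (≤-reflexive (ℕ.+-suc x d)))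

  kids-complete : ∀ ℓ → Inv Q ℓ → ∀ {s} → A s → ∃ λ ℓ′ → (s , ℓ′) ∈ kids ℓ
  kids-complete Z inv As with InvZ.A⇒ inv As
  ... | z≤n = _ , here refl
  kids-complete (E j) inv As with m≤n⇒m<n∨m≡n (InvE.A⇒ inv As)
  ... | inj₂ refl = _ , ∈-++⁺ʳ (run B 0 j) (there (here refl))
  ... | inj₁ (s≤s s≤j) with m≤n⇒m<n∨m≡n s≤j
  ...   | inj₂ refl = _ , ∈-++⁺ʳ (run B 0 j) (here refl)
  ...   | inj₁ s<j  = _ , ∈-++⁺ˡ (proj₂ (∈-run B 0 j z≤n s<j))
  kids-complete (D j) inv As with m≤n⇒m<n∨m≡n (InvD.A⇒ inv As)
  ... | inj₂ refl = _ , ∈-++⁺ʳ (run B 0 j) (there (there (here refl)))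
  ... | inj₁ (s≤s s≤1+j) with m≤n⇒m<n∨m≡n s≤1+j
  ...   | inj₂ refl = _ , ∈-++⁺ʳ (run B 0 j) (there (here refl))
  ...   | inj₁ (s≤s s≤j) with m≤n⇒m<n∨m≡n s≤j
  ...     | inj₂ refl = _ , ∈-++⁺ʳ (run B 0 j) (here refl)
  ...     | inj₁ s<j  = _ , ∈-++⁺ˡ (proj₂ (∈-run B 0 j z≤n s<j))
  kids-complete (B x i) inv As with InvB.A⇒ inv As
  ... | x≤s , s≤2+c with m≤n⇒m<n∨m≡n x≤s
  ...   | inj₂ refl = _ , here refl
  ...   | inj₁ x<s with m≤n⇒m<n∨m≡n s≤2+c
  ...     | inj₂ refl = _ , there (∈-++⁺ʳ (run (λ y d → W y (2 ℕ.+ d)) (suc x) i) (there (here refl)))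
  ...     | inj₁ (s≤s s≤1+c) with m≤n⇒m<n∨m≡n s≤1+c
  ...       | inj₂ refl = _ , there (∈-++⁺ʳ (run (λ y d → W y (2 ℕ.+ d)) (suc x) i) (here refl))
  ...       | inj₁ s<1+c = _ , there (∈-++⁺ˡ (proj₂ (∈-run (λ y d → W y (2 ℕ.+ d)) (suc x) i x<s s<1+c)))
  kids-complete (G j z) inv As with InvG.A⇒ inv As
  ... | inj₂ refl = _ , ∈-++⁺ʳ (run (λ y d → W y (suc d)) 0 (suc j)) (there (here refl))
  ... | inj₁ s≤1+j with m≤n⇒m<n∨m≡n s≤1+j
  ...   | inj₂ refl  = _ , ∈-++⁺ʳ (run (λ y d → W y (suc d)) 0 (suc j)) (here refl)
  ...   | inj₁ s<1+j = _ , ∈-++⁺ˡ (proj₂ (∈-run (λ y d → W y (suc d)) 0 (suc j) z≤n s<1+j))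
  kids-complete (P x z) (inv , _) As with InvPair.A⇒ inv As
  ... | inj₁ refl = _ , here refl
  ... | inj₂ refl = _ , there (here refl)
  kids-complete (V x z) (inv , _) As with InvPair.A⇒ inv As
  ... | inj₁ refl = _ , here refl
  ... | inj₂ refl = _ , there (here refl)
  kids-complete (G′ x z) inv As with InvG′.A⇒ inv As
  ... | inj₁ refl        = _ , here refl
  ... | inj₂ (inj₁ refl) = _ , there (here refl)
  ... | inj₂ (inj₂ refl) = _ , there (there (here refl))
  kids-complete (W x d) inv As with InvW.A⇒ inv As
  ... | x≤s , s≤e = ∈-run W x (suc d) x≤s (≤-trans (s≤s s≤e) (≤-reflexive (sym (ℕ.+-suc x d))))

  -- Needed for the distinctness of siblings. The invariant enters because a label alone does not
  -- say that x lies before z.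
  kids-increase : ∀ ℓ → Inv Q ℓ → SitesIncreaseFrom 0 (kids ℓ)
  kids-increase Z        inv       = z≤n , tt
  kids-increase (E j)    inv       = sitesIncrease-run B 0 j (≤-refl , ≤-refl , tt)
  kids-increase (D j)    inv       = sitesIncrease-run B 0 j (≤-refl , ≤-refl , ≤-refl , tt)
  kids-increase (B x i)  inv       =
    z≤n , sitesIncrease-run (λ y d → W y (2 ℕ.+ d)) (suc x) i (≤-refl , ≤-refl , tt)
  kids-increase (G j z)  inv       =
    sitesIncrease-run (λ y d → W y (suc d)) 0 (suc j) (≤-refl , InvG.j<z inv , tt)
  kids-increase (P x z)  (inv , _) = z≤n , InvPair.x<z inv , tt
  kids-increase (V x z)  (inv , _) = z≤n , InvPair.x<z inv , tt
  kids-increase (G′ x z) inv       = z≤n , InvG′.x<z inv , ≤-refl , tt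
  kids-increase (W x d)  inv       = sitesIncrease-weaken (run W x (suc d)) z≤n
    (subst (SitesIncreaseFrom x) (++-identityʳ (run W x (suc d))) (sitesIncrease-run W x (suc d) tt))

-- Permutations as paths of the generating tree

values : ∀ {n m} → Vec (Fin m) n → Fin n → ℕ
values σ x = toℕ (lookup σ x)

increasing₄ : (u : Fin 4 → ℕ) → u 0F < u 1F → u 1F < u 2F → u 2F < u 3F → ∀ a b → a Fin.< b → u a < u b
increasing₄ u p q r 0F 1F _ = p
increasing₄ u p q r 0F 2F _ = <-trans p q
increasing₄ u p q r 0F 3F _ = <-trans p (<-trans q r)
increasing₄ u p q r 1F 2F _ = q
increasing₄ u p q r 1F 3F _ = <-trans q r
increasing₄ u p q r 2F 3F _ = r
increasing₄ u p q r 1F 1F (s≤s ())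
increasing₄ u p q r 2F 1F (s≤s ())
increasing₄ u p q r 2F 2F (s≤s (s≤s ()))
increasing₄ u p q r 3F 1F (s≤s ())
increasing₄ u p q r 3F 2F (s≤s (s≤s ()))
increasing₄ u p q r 3F 3F (s≤s (s≤s (s≤s ())))

module _ {n : ℕ} (σ : Vec (Fin n) n) where

  -- `u` lists the four values in increasing order, so that three consecutive comparisons yield the
  -- order condition for all pairs, whatever `τ` is.
  occurrence : (τ : Vec (Fin 4) 4) (w x y z : Fin n) → w Fin.< x → x Fin.< y → y Fin.< z →
    (u : Fin 4 → ℕ) → u 0F < u 1F → u 1F < u 2F → u 2F < u 3F →
    values σ w ≡ u (lookup τ 0F) → values σ x ≡ u (lookup τ 1F) →
    values σ y ≡ u (lookup τ 2F) → values σ z ≡ u (lookup τ 3F) → Contains σ τ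
  occurrence τ w x y z w<x x<y y<z u u₀₁ u₁₂ u₂₃ ew ex ey ez =
    lookup f , increasing₄ (toℕ ∘ lookup f) w<x x<y y<z , λ a b τa<τb →
      subst₂ _<_ (sym (value a)) (sym (value b)) (increasing₄ u u₀₁ u₁₂ u₂₃ (lookup τ a) (lookup τ b) τa<τb)
    where
    f : Vec (Fin n) 4
    f = w ∷ x ∷ y ∷ z ∷ []
    value : ∀ a → values σ (lookup f a) ≡ u (lookup τ a)
    value 0F = ew
    value 1F = ex
    value 2F = ey
    value 3F = ez

  private
    from₄ : ℕ → ℕ → ℕ → ℕ → Fin 4 → ℕ
    from₄ a b c d = lookup (a ∷ b ∷ c ∷ d ∷ [])

    0<1 : ∀ {n} → 0 < suc n
    0<1 = s≤s z≤n
    1<2 : ∀ {n} → 1 < suc (suc n)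
    1<2 = s≤s 0<1
    2<3 : ∀ {n} → 2 < suc (suc (suc n))
    2<3 = s≤s 1<2

  avoids⇒avoiding : Avoids σ p1243 → Avoids σ p2341 → Avoids σ p3412 → Avoiding (values σ)
  avoids⇒avoiding av1243 av2341 av3412 =
    (λ { (w , x , y , z , w<x , x<y , y<z , a , b , c) → av1243
         (occurrence p1243 w x y z w<x x<y y<z
           (from₄ (values σ w) (values σ x) (values σ z) (values σ y)) a b c refl refl refl refl) }) ,
    (λ { (w , x , y , z , w<x , x<y , y<z , a , b , c) → av2341
         (occurrence p2341 w x y z w<x x<y y<z
           (from₄ (values σ z) (values σ w) (values σ x) (values σ y)) a b c refl refl refl refl) }) ,
    (λ { (w , x , y , z , w<x , x<y , y<z , a , b , c) → av3412
         (occurrence p3412 w x y z w<x x<y y<z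
           (from₄ (values σ y) (values σ z) (values σ w) (values σ x)) a b c refl refl refl refl) })

  avoiding⇒avoids : Avoiding (values σ) → Avoids σ p1243 × Avoids σ p2341 × Avoids σ p3412
  avoiding⇒avoids (¬h1243 , ¬h2341 , ¬h3412) =
    (λ { (f , f-mono , f-ord) → ¬h1243 (f 0F , f 1F , f 2F , f 3F ,
         f-mono 0F 1F 0<1 , f-mono 1F 2F 1<2 , f-mono 2F 3F 2<3 , f-ord 0F 1F 0<1 , f-ord 1F 3F 1<2 , f-ord 3F 2F 2<3) }) ,
    (λ { (f , f-mono , f-ord) → ¬h2341 (f 0F , f 1F , f 2F , f 3F ,
         f-mono 0F 1F 0<1 , f-mono 1F 2F 1<2 , f-mono 2F 3F 2<3 , f-ord 3F 0F 0<1 , f-ord 0F 1F 1<2 , f-ord 1F 2F 2<3) }) ,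
    (λ { (f , f-mono , f-ord) → ¬h3412 (f 0F , f 1F , f 2F , f 3F ,
         f-mono 0F 1F 0<1 , f-mono 1F 2F 1<2 , f-mono 2F 3F 2<3 , f-ord 2F 3F 0<1 , f-ord 3F 0F 1<2 , f-ord 0F 1F 2<3) })

lookup-ext : ∀ {a} {A : Set a} {n} (xs ys : Vec A n) → (∀ i → lookup xs i ≡ lookup ys i) → xs ≡ ys
lookup-ext xs ys eq = trans (sym (tabulate∘lookup xs)) (trans (tabulate-cong eq) (tabulate∘lookup ys))

module _ {n : ℕ} where

  insertMin : Fin (suc n) → Vec (Fin n) n → Vec (Fin (suc n)) (suc n)
  insertMin p σ = insertAt (Vec.map Fin.suc σ) p Fin.zero

  lookup-insertMin : ∀ p σ → lookup (insertMin p σ) p ≡ Fin.zero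
  lookup-insertMin p σ = insertAt-lookup (Vec.map Fin.suc σ) p Fin.zero

  lookup-insertMin-punchIn : ∀ p σ y → lookup (insertMin p σ) (punchIn p y) ≡ Fin.suc (lookup σ y)
  lookup-insertMin-punchIn p σ y =
    trans (insertAt-punchIn (Vec.map Fin.suc σ) p Fin.zero y) (lookup-map y Fin.suc σ)

  insertMin-injective : ∀ {p q σ τ} → insertMin p σ ≡ insertMin q τ → p ≡ q × σ ≡ τ
  insertMin-injective {p} {q} {σ} {τ} eq with punchIn-view q p
  ... | inj₂ (y , refl) = contradiction
    (trans (sym (lookup-insertMin p σ)) (trans (cong (λ v → lookup v p) eq) (lookup-insertMin-punchIn q τ y))) λ ()
  ... | inj₁ refl = refl , lookup-ext σ τ λ y → Fin.suc-injective
    (trans (sym (lookup-insertMin-punchIn p σ y))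
      (trans (cong (λ v → lookup v (punchIn p y)) eq) (lookup-insertMin-punchIn p τ y)))

  insertMin-perm : ∀ p {σ} → IsPerm σ → IsPerm (insertMin p σ)
  insertMin-perm p {σ} perm i j eq with punchIn-view p i | punchIn-view p j
  ... | inj₁ refl       | inj₁ refl       = refl
  ... | inj₁ refl       | inj₂ (b , refl) =
    contradiction (trans (sym (lookup-insertMin p σ)) (trans eq (lookup-insertMin-punchIn p σ b))) λ ()
  ... | inj₂ (a , refl) | inj₁ refl       =
    contradiction (trans (sym (lookup-insertMin p σ)) (trans (sym eq) (lookup-insertMin-punchIn p σ a))) λ ()
  ... | inj₂ (a , refl) | inj₂ (b , refl) = cong (punchIn p) (perm a b (Fin.suc-injective
    (trans (sym (lookup-insertMin-punchIn p σ a)) (trans eq (lookup-insertMin-punchIn p σ b)))))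

  insertMin-perm⁻ : ∀ p {σ} → IsPerm (insertMin p σ) → IsPerm σ
  insertMin-perm⁻ p {σ} perm i j eq = punchIn-injective p i j (perm (punchIn p i) (punchIn p j)
    (trans (lookup-insertMin-punchIn p σ i) (trans (cong Fin.suc eq) (sym (lookup-insertMin-punchIn p σ j)))))

  -- Pigeonhole: if zero were missed, `punchOut` would inject `Fin (suc n)` into `Fin n`.
  perm-attains-zero : ∀ {σ : Vec (Fin (suc n)) (suc n)} → IsPerm σ → ∃ λ p → lookup σ p ≡ Fin.zero
  perm-attains-zero {σ} perm with any? (λ p → lookup σ p Fin.≟ Fin.zero)
  ... | yes attained = attained
  ... | no ¬attained = contradiction
    (injective⇒≤ {f = λ p → punchOut (≢0 p)} λ {i} {j} eq → perm i j (punchOut-injective (≢0 i) (≢0 j) eq)) 1+n≰n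
    where
    ≢0 : ∀ p → Fin.zero ≢ lookup σ p
    ≢0 p eq = ¬attained (p , sym eq)

  perm-insertMin : ∀ (σ : Vec (Fin (suc n)) (suc n)) → IsPerm σ → ∃₂ λ p τ → σ ≡ insertMin p τ
  perm-insertMin σ perm with perm-attains-zero {σ} perm
  ... | p , σp≡0 = p , τ , lookup-ext σ (insertMin p τ) agree
    where
    ≢0 : ∀ y → Fin.zero ≢ lookup σ (punchIn p y)
    ≢0 y eq = punchInᵢ≢i p y (perm _ _ (trans (sym eq) (sym σp≡0)))
    τ : Vec (Fin n) n
    τ = tabulate λ y → punchOut (≢0 y)
    agree : ∀ i → lookup σ i ≡ lookup (insertMin p τ) i
    agree i with punchIn-view p i
    ... | inj₁ refl       = trans σp≡0 (sym (lookup-insertMin p τ))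
    ... | inj₂ (y , refl) = trans (sym (punchIn-punchOut (≢0 y)))
      (trans (cong Fin.suc (sym (lookup∘tabulate (λ y → punchOut (≢0 y)) y))) (sym (lookup-insertMin-punchIn p τ y)))

  module InsertMinValues (p : Fin (suc n)) (σ : Vec (Fin n) n) =
    InsertMin p (values σ) (values (insertMin p σ))
      (cong toℕ (lookup-insertMin p σ)) (λ y → cong toℕ (lookup-insertMin-punchIn p σ y))

-- Sites beyond the end are truncated.
site : ∀ n → ℕ → Fin (suc n)
site n       zero    = Fin.zero
site zero    (suc s) = Fin.zero
site (suc n) (suc s) = Fin.suc (site n s)

toℕ-site : ∀ {n s} → s ≤ n → toℕ (site n s) ≡ s
toℕ-site                   z≤n       = refl
toℕ-site {suc n} {suc s} (s≤s s≤n) = cong suc (toℕ-site s≤n)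

Node : ℕ → Set
Node n = Vec (Fin n) n × Label

expand : ∀ {n} → Node n → List (Node (suc n))
expand {n} (σ , ℓ) = List.map (λ { (s , ℓ′) → insertMin (site n s) σ , ℓ′ }) (kids ℓ)

level : ∀ n → List (Node n)
level zero    = ([] , Z) ∷ []
level (suc n) = concatMap expand (level n)

Sound : ∀ {n} → Node n → Set
Sound (σ , ℓ) = IsPerm σ × Avoiding (values σ) × Inv (profile (values σ)) ℓ

expand-sound : ∀ {n} {ν : Node n} → Sound ν → All Sound (expand ν)
expand-sound {n} {σ , ℓ} (perm , av , inv) = All.map⁺ (All.map sound (kids-realised ℓ inv))
  where
  sound : ∀ {k} → Realises (profile (values σ)) k → Sound (insertMin (site n (proj₁ k)) σ , proj₂ k)
  sound {s , ℓ′} (active , next) =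
    insertMin-perm p {σ} perm ,
    avoiding⇐ av (subst (Active (values σ)) (sym p≡s) active) ,
    next (subst (Inserted _ _) p≡s inserted)
    where
    p : Fin (suc n)
    p = site n s
    p≡s : toℕ p ≡ s
    p≡s = toℕ-site (proj₁ active)
    open InsertMinValues p σ

level-sound : ∀ n → All Sound (level n)
level-sound zero    = ((λ ()) , ((λ { (() , _) }) , (λ { (() , _) }) , (λ { (() , _) })) , record
  { A⇒ = proj₁ ; A⇐ = z≤n , (λ { (() , _) }) , (λ { (() , _) }) , (λ { (() , _) }) ; inc = λ () }) ∷ []
level-sound (suc n) = All.concat⁺ (All.map⁺ (All.map expand-sound (level-sound n)))

level-complete : ∀ {n} (σ : Vec (Fin n) n) → IsPerm σ → Avoiding (values σ) → ∃ λ ℓ → (σ , ℓ) ∈ level n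
level-complete {zero}  []  _    _  = Z , here refl
level-complete {suc n} σ′ perm av with perm-insertMin σ′ perm
... | p , σ , refl with InsertMinValues.avoiding⇒ p σ av
...   | avσ , active with level-complete σ (insertMin-perm⁻ p perm) avσ
...     | ℓ , σ∈ with kids-complete ℓ (proj₂ (proj₂ (All.lookup (level-sound n) σ∈))) active
...       | ℓ′ , k∈ = ℓ′ , ∈-concat⁺′
  -- Children store sites as numbers; an active site is at most `n`, so `site` returns `p` without
  -- truncation.
  (subst (λ q → (insertMin q σ , ℓ′) ∈ expand (σ , ℓ)) (toℕ-injective (toℕ-site (proj₁ active)))
    (∈-map⁺ (λ { (s , ℓ′) → insertMin (site n s) σ , ℓ′ }) k∈))
  (∈-map⁺ expand σ∈)

-- Distinct nodes would not suffice: the same permutation must not occur under two labels, since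
-- labels are dropped in the end.
_≢₁_ : ∀ {n} → Node n → Node n → Set
_≢₁_ = _≢_ on proj₁

expand-distinct : ∀ {n} {ν : Node n} → Sound ν → AllPairs _≢₁_ (expand ν)
expand-distinct {n} {σ , ℓ} (_ , _ , inv) = AllPairs.map⁺
  (distinct (kids ℓ) (All.map (proj₁ ∘ proj₁) (kids-realised ℓ inv)) (kids-increase ℓ inv))
  where
  later : ∀ {lo} ks → SitesIncreaseFrom lo ks → All (λ k → lo ≤ proj₁ k) ks
  later []       _            = []
  later (k ∷ ks) (lo≤s , inc) = lo≤s ∷ later ks (sitesIncrease-weaken ks (≤-trans lo≤s (n≤1+n _)) inc)
  distinct : ∀ {lo} ks → All (λ k → proj₁ k ≤ n) ks → SitesIncreaseFrom lo ks →
    AllPairs (λ k k′ → insertMin (site n (proj₁ k)) σ ≢ insertMin (site n (proj₁ k′)) σ) ks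
  distinct []       _            _         = []
  distinct (k ∷ ks) (s≤n ∷ ≤n) (_ , inc) =
    All.zipWith (λ { (s′≤n , s<s′) eq → <⇒≢ s<s′
      (trans (sym (toℕ-site s≤n)) (trans (cong toℕ (proj₁ (insertMin-injective eq))) (toℕ-site s′≤n))) })
      (≤n , later ks inc) ∷
    distinct ks ≤n inc

-- Deleting the minimum recovers the parent and the site, so children of different parents differ,
-- and so do siblings at different sites.
level-distinct : ∀ n → AllPairs _≢₁_ (level n)
level-distinct zero    = [] ∷ []
level-distinct (suc n) = AllPairs.concat⁺
  (All.map⁺ (All.map expand-distinct (level-sound n)))
  (AllPairs.map⁺ (AllPairs.map (λ {ν} {ν′} → apart {ν} {ν′}) (level-distinct n)))
  where
  apart : ∀ {ν ν′ : Node n} → ν ≢₁ ν′ → All (λ μ → All (μ ≢₁_) (expand ν′)) (expand ν)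
  apart {σ , ℓ} {σ′ , ℓ′} σ≢σ′ = All.map⁺ (All.universal (λ k → All.map⁺ (All.universal (λ k′ eq →
    σ≢σ′ (proj₂ (insertMin-injective eq))) (kids ℓ′))) (kids ℓ))

-- Counting

+-congˡ : ∀ a {b c} → b ≡ c → a + b ≡ a + c
+-congˡ a = cong (λ b → a + b)

sumBy : ∀ {a} {A : Set a} → (A → ℤ) → List A → ℤ
sumBy h = foldr (λ x s → h x + s) (+ 0)

sumBy-++ : ∀ {a} {A : Set a} (h : A → ℤ) xs ys → sumBy h (xs ++ ys) ≡ sumBy h xs + sumBy h ys
sumBy-++ h []       ys = sym (ℤ.+-identityˡ _)
sumBy-++ h (x ∷ xs) ys = trans (+-congˡ (h x) (sumBy-++ h xs ys)) (sym (ℤ.+-assoc (h x) _ _))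

sumBy-map : ∀ {a b} {A : Set a} {B : Set b} (h : B → ℤ) (f : A → B) xs → sumBy h (List.map f xs) ≡ sumBy (h ∘ f) xs
sumBy-map h f []       = refl
sumBy-map h f (x ∷ xs) = +-congˡ (h (f x)) (sumBy-map h f xs)

sumBy-concatMap : ∀ {a b} {A : Set a} {B : Set b} (h : B → ℤ) (f : A → List B) xs →
  sumBy h (concatMap f xs) ≡ sumBy (sumBy h ∘ f) xs
sumBy-concatMap h f []       = refl
sumBy-concatMap h f (x ∷ xs) = trans (sumBy-++ h (f x) _) (+-congˡ (sumBy h (f x)) (sumBy-concatMap h f xs))

sumBy-cong : ∀ {a} {A : Set a} {h h′ : A → ℤ} → (∀ x → h x ≡ h′ x) → ∀ xs → sumBy h xs ≡ sumBy h′ xs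
sumBy-cong eq []       = refl
sumBy-cong eq (x ∷ xs) = cong₂ _+_ (eq x) (sumBy-cong eq xs)

length≡sumBy-1 : ∀ {a} {A : Set a} (xs : List A) → + length xs ≡ sumBy (λ _ → + 1) xs
length≡sumBy-1 []       = refl
length≡sumBy-1 (x ∷ xs) = +-congˡ (+ 1) (length≡sumBy-1 xs)

count : ℕ → Label → ℤ
count zero    ℓ = + 1
count (suc m) ℓ = sumBy (λ k → count m (proj₂ k)) (kids ℓ)

-- The depth `m` is free so that the induction can trade the last level for one more generation of
-- descendants.
level-count : ∀ m n → sumBy (count m ∘ proj₂) (level n) ≡ count (n ℕ.+ m) Z
level-count m zero    = ℤ.+-identityʳ _
level-count m (suc n) = begin
  sumBy (count m ∘ proj₂) (concatMap expand (level n))       ≡⟨ sumBy-concatMap (count m ∘ proj₂) expand (level n) ⟩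
  sumBy (sumBy (count m ∘ proj₂) ∘ expand) (level n)         ≡⟨ sumBy-cong (λ { (σ , ℓ) → sumBy-map (count m ∘ proj₂) _ (kids ℓ) }) (level n) ⟩
  sumBy (count (suc m) ∘ proj₂) (level n)                    ≡⟨ level-count (suc m) n ⟩
  count (n ℕ.+ suc m) Z                                      ≡⟨ cong (λ i → count i Z) (ℕ.+-suc n m) ⟩
  count (suc n ℕ.+ m) Z                                      ∎
  where open ≡-Reasoning

-- The coefficient of x^m in f(x) / (1 - x)^k.
partialSum : (ℕ → ℤ) → ℕ → ℕ → ℤ
partialSum f m       zero    = f m
partialSum f zero    (suc k) = partialSum f zero k
partialSum f (suc m) (suc k) = partialSum f m (suc k) + partialSum f (suc m) k

partialSum-0 : ∀ f k → partialSum f 0 k ≡ f 0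
partialSum-0 f zero    = refl
partialSum-0 f (suc k) = partialSum-0 f k

-- w m d is the coefficient of x^m in 1 / (1 - x)^(d+1), and t₁, t₂, t₃ have the generating functions
-- 1 / (1 - 2x), x / (1 - 2x)^2 and x^2 / (1 - 2x)^3.
w : ℕ → ℕ → ℤ
w = partialSum (λ _ → + 1)

t₁ t₂ t₃ : ℕ → ℤ
t₁ zero    = + 1
t₁ (suc m) = + 2 * t₁ m
t₂ zero    = + 0
t₂ (suc m) = + 2 * t₂ m + t₁ m
t₃ zero    = + 0
t₃ (suc m) = + 2 * t₃ m + t₂ m

-- F has the generating function 1 / (1 - 3x + x^2), and ε has (2 - x) / (1 - 3x + x^2) - 1 / (1 - 2x).
F ε : ℕ → ℤ
F zero          = + 1
F (suc zero)    = + 3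
F (suc (suc m)) = + 3 * F (suc m) - F m
ε zero    = + 1
ε (suc m) = + 2 * F (suc m) - F m - t₁ (suc m)

φ η : ℕ → ℕ → ℤ
φ = partialSum F
η = partialSum ε

φ-1 : ∀ m → φ m 1 ≡ F (suc m) - F m - + 1
φ-1 zero    = refl
φ-1 (suc m) rewrite φ-1 m = lemma (F m) (F (suc m))
  where
  lemma : ∀ a b → b - a - + 1 + b ≡ + 3 * b - a - b - + 1
  lemma = solve-∀

-- Besides starting the induction for `η-suc`, this evaluates the count of `E 0`, the only child of
-- the root, and so produces the first fraction of the theorem.
η-1 : ∀ m → η m 1 ≡ F (suc m) - t₁ (suc m)
η-1 zero    = refl
η-1 (suc m) rewrite η-1 m = lemma (F m) (F (suc m)) (t₁ (suc m))
  where
  lemma : ∀ a b c → b - c + (+ 2 * b - a - c) ≡ + 3 * b - a - + 2 * c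
  lemma = solve-∀

-- With k = j+2 this is the recurrence of `D j`: the φ terms are the children `D j` and `D (suc j)`,
-- the w term collects the `B` children and `G`. For a(x) / (1 - x)^k it reads a = xa + xa/(1 - x) +
-- 1/(1 - x), which forces a = 1 / (1 - 3x + x^2). Both sides obey the recursion of `partialSum`, so
-- the content lies in the boundary k = 0.
φ-suc : ∀ m k → φ (suc m) k ≡ φ m k + φ m (suc k) + w (suc m) k
φ-suc m zero rewrite φ-1 m = lemma (F m) (F (suc m))
  where
  lemma : ∀ a b → b ≡ a + (b - a - + 1) + + 1
  lemma = solve-∀
φ-suc zero (suc k) rewrite φ-suc zero k | partialSum-0 F k | partialSum-0 (λ _ → + 1) k = lemma (w 1 k)
  where
  lemma : ∀ a → + 1 + (+ 1 + + 1 + a) ≡ + 1 + + 1 + (+ 1 + a)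
  lemma = solve-∀
φ-suc (suc m) (suc k) = trans (cong₂ _+_ (φ-suc m (suc k)) (φ-suc (suc m) k))
  (lemma (φ m (suc k)) (φ m (suc (suc k))) (w m (suc k)) (w (suc m) k) (φ (suc m) k) (w (suc (suc m)) k))
  where
  lemma : ∀ a b c d e f → a + b + (c + d) + (e + (a + e) + f) ≡ a + e + (b + (a + e)) + (c + d + f)
  lemma = solve-∀

-- With k = j+1 this is the recurrence of `E j`, whose children are `E (suc j)`, `D j` and a run of
-- `B`. It forces the numerator series (1 - x)^2 / ((1 - 2x)(1 - 3x + x^2)), of which `ε` is the
-- partial fraction form.
η-suc : ∀ m k → η (suc m) k ≡ η m (suc k) + φ m (suc k) + w (suc m) k
η-suc m zero rewrite φ-1 m | η-1 m = lemma (F m) (F (suc m)) (t₁ (suc m))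
  where
  lemma : ∀ a b c → + 2 * b - a - c ≡ (b - c) + (b - a - + 1) + + 1
  lemma = solve-∀
η-suc zero (suc k)
  rewrite η-suc zero k | partialSum-0 F k | partialSum-0 ε k | partialSum-0 (λ _ → + 1) k = lemma (w 1 k)
  where
  lemma : ∀ a → + 1 + (+ 1 + + 1 + a) ≡ + 1 + + 1 + (+ 1 + a)
  lemma = solve-∀
η-suc (suc m) (suc k) = trans (cong₂ _+_ (η-suc m (suc k)) (η-suc (suc m) k))
  (lemma (η m (suc (suc k))) (φ m (suc (suc k))) (w m (suc k)) (w (suc m) k)
    (η m (suc k)) (η (suc m) k) (φ m (suc k)) (φ (suc m) k) (w (suc (suc m)) k))
  where
  lemma : ∀ a b c d e f g h i →
    a + b + (c + d) + (e + f + (g + h) + i) ≡ a + (e + f) + (b + (g + h)) + (c + d + i)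
  lemma = solve-∀

sumBelow : (ℕ → ℤ) → ℕ → ℤ
sumBelow h zero    = + 0
sumBelow h (suc d) = h d + sumBelow h d

-- The hockey-stick identity; it telescopes by the defining recursion of `w`.
sumBelow-w : ∀ m r d → sumBelow (λ i → w m (suc r ℕ.+ i)) d ≡ w (suc m) (r ℕ.+ d) - w (suc m) r
sumBelow-w m r zero    rewrite ℕ.+-identityʳ r = sym (ℤ.+-inverseʳ (w (suc m) r))
sumBelow-w m r (suc d) rewrite sumBelow-w m r d | ℕ.+-suc r d =
  sym (ℤ.+-assoc (w m (suc (r ℕ.+ d))) _ _)

sumBelow-w₀ : ∀ m d → sumBelow (w m) (suc d) ≡ w (suc m) d
sumBelow-w₀ m zero    = refl
sumBelow-w₀ m (suc d) = +-congˡ (w m (suc d)) (sumBelow-w₀ m d)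

sumBelow-+ : ∀ h c d → sumBelow (λ i → h i + c) d ≡ sumBelow h d + + d * c
sumBelow-+ h c zero    = sym (ℤ.*-zeroˡ c)
sumBelow-+ h c (suc d) rewrite sumBelow-+ h c d = lemma (h d) c (sumBelow h d) (+ d)
  where
  lemma : ∀ a c s d → a + c + (s + d * c) ≡ a + s + (+ 1 + d) * c
  lemma = solve-∀

-- The constant terms and the coefficients of the label parameter in the closed forms below, found by solving the
-- recurrences of the generating tree and expanding in partial fractions.
β β′ γ δ : ℕ → ℤ
β  m = + 1 + + 2 * w m 1 - w m 2 + w m 3 - + 3 * t₁ m - + 2 * t₂ m + + 2 * t₃ m
β′ m = + 2 + w m 1 + w m 3 - + 4 * t₁ m - + 2 * t₂ m + + 2 * t₃ m
γ  m = + 2 + + 2 * w m 2 - w m 3 - + 3 * t₁ m + + 2 * t₂ m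
δ  m = + 2 * t₁ m + w m 3 - + 3 * w m 2 + w m 1 - + 1

-- The positions x and z do not enter, only the lengths of the intervals of sites. `Z` is separate
-- because the root has no sibling family: it only passes on to `E 0`.
closedForm : ℕ → Label → ℤ
closedForm m (E j)    = η m (suc j) + β′ m + + j * γ m
closedForm m (D j)    = φ m (2 ℕ.+ j) + β m + + j * γ m
closedForm m (B x i)  = w m (2 ℕ.+ i) + δ m
closedForm m (G j z)  = w m (2 ℕ.+ j) - w m 1 + t₁ m
closedForm m (P x z)  = t₁ m
closedForm m (V x z)  = w m 1
closedForm m (G′ x z) = t₁ m + w m 2 - w m 1
closedForm m (W x d)  = w m d
closedForm zero    Z  = + 1
closedForm (suc m) Z  = closedForm m (E 0)

closedForm-0 : ∀ ℓ → closedForm 0 ℓ ≡ + 1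
closedForm-0 Z        = refl
closedForm-0 (E j)    rewrite partialSum-0 ε j | ℤ.*-zeroʳ (+ j) = refl
closedForm-0 (D j)    rewrite partialSum-0 F j | ℤ.*-zeroʳ (+ j) = refl
closedForm-0 (B x i)  rewrite partialSum-0 (λ _ → + 1) i = refl
closedForm-0 (G j z)  rewrite partialSum-0 (λ _ → + 1) j = refl
closedForm-0 (P x z)  = refl
closedForm-0 (V x z)  = refl
closedForm-0 (G′ x z) = refl
closedForm-0 (W x d)  = partialSum-0 (λ _ → + 1) d

-- The closed forms satisfy the recurrences of the tree

module _ (m : ℕ) where

  sumKids : List Kid → ℤ
  sumKids = sumBy (λ k → closedForm m (proj₂ k))

  -- A run lists its second arguments downwards, the order in which `sumBelow` unfolds.
  sumKids-run : ∀ g h x d ks → (∀ y i → closedForm m (g y i) ≡ h i) →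
    sumKids (run g x d ++ ks) ≡ sumBelow h d + sumKids ks
  sumKids-run g h x zero    ks eq = sym (ℤ.+-identityˡ _)
  sumKids-run g h x (suc d) ks eq = trans
    (cong₂ _+_ (eq (suc x) d) (sumKids-run g h (suc x) d ks eq)) (sym (ℤ.+-assoc (h d) _ _))

  sumKids-B : ∀ j ks → sumKids (run B 0 j ++ ks) ≡ w (suc m) (suc j) - w (suc m) 1 + + j * δ m + sumKids ks
  sumKids-B j ks = trans (sumKids-run B (λ i → w m (2 ℕ.+ i) + δ m) 0 j ks λ _ _ → refl)
    (cong (λ s → s + sumKids ks) (trans (sumBelow-+ (λ i → w m (2 ℕ.+ i)) (δ m) j)
      (cong (λ s → s + + j * δ m) (sumBelow-w m 1 j))))

  closedForm-suc : ∀ ℓ → sumKids (kids ℓ) ≡ closedForm (suc m) ℓ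
  closedForm-suc Z        = ℤ.+-identityʳ _
  closedForm-suc (E j)    = trans (sumKids-B j _) (trans
    (lemma (η m (2 ℕ.+ j)) (φ m (2 ℕ.+ j)) (w (suc m) (suc j)) (w m 1) (w m 2) (w m 3) (t₁ m) (t₂ m) (t₃ m) (+ j))
    (cong (λ s → s + β′ (suc m) + + j * γ (suc m)) (sym (η-suc m (suc j)))))
    where
    -- Here `β′` and `β′′` are the values of the function `β′` at `m` and `suc m`; the other primes
    -- mark values at `suc m`.
    lemma : ∀ e f g w₁ w₂ w₃ a b c k →
      let β    = + 1 + + 2 * w₁ - w₂ + w₃ - + 3 * a - + 2 * b + + 2 * c
          β′   = + 2 + w₁ + w₃ - + 4 * a - + 2 * b + + 2 * c
          γ    = + 2 + + 2 * w₂ - w₃ - + 3 * a + + 2 * b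
          δ    = + 2 * a + w₃ - + 3 * w₂ + w₁ - + 1
          w₁′  = w₁ + + 1
          w₂′  = w₂ + w₁′
          w₃′  = w₃ + w₂′
          a′   = + 2 * a
          b′   = + 2 * b + a
          c′   = + 2 * c + b
          β′′  = + 2 + w₁′ + w₃′ - + 4 * a′ - + 2 * b′ + + 2 * c′
          γ′   = + 2 + + 2 * w₂′ - w₃′ - + 3 * a′ + + 2 * b′
      in g - w₁′ + k * δ + (f + β + k * γ + (e + β′ + (+ 1 + k) * γ + + 0)) ≡
         e + f + g + β′′ + k * γ′
    lemma = solve-∀
  closedForm-suc (D j)    = trans (sumKids-B j _) (trans
    (lemma (φ m (2 ℕ.+ j)) (φ m (3 ℕ.+ j)) (w (suc m) (suc j)) (w m (2 ℕ.+ j)) (w m 1) (w m 2) (w m 3)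
      (t₁ m) (t₂ m) (t₃ m) (+ j))
    (cong (λ s → s + β (suc m) + + j * γ (suc m)) (sym (φ-suc m (2 ℕ.+ j)))))
    where
    lemma : ∀ e f g h w₁ w₂ w₃ a b c k →
      let β    = + 1 + + 2 * w₁ - w₂ + w₃ - + 3 * a - + 2 * b + + 2 * c
          γ    = + 2 + + 2 * w₂ - w₃ - + 3 * a + + 2 * b
          δ    = + 2 * a + w₃ - + 3 * w₂ + w₁ - + 1
          w₁′  = w₁ + + 1
          w₂′  = w₂ + w₁′
          w₃′  = w₃ + w₂′
          a′   = + 2 * a
          b′   = + 2 * b + a
          c′   = + 2 * c + b
          β′   = + 1 + + 2 * w₁′ - w₂′ + w₃′ - + 3 * a′ - + 2 * b′ + + 2 * c′
          γ′   = + 2 + + 2 * w₂′ - w₃′ - + 3 * a′ + + 2 * b′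
      in g - w₁′ + k * δ + (e + β + k * γ + (f + β + (+ 1 + k) * γ + (h - w₁ + a + + 0))) ≡
         e + f + (h + g) + β′ + k * γ′
    lemma = solve-∀
  closedForm-suc (B x i)  = trans
    (+-congˡ (w m (2 ℕ.+ i) + δ m) (trans (sumKids-run (λ y d → W y (2 ℕ.+ d)) (λ d → w m (2 ℕ.+ d)) (suc x) i
      ((suc (x ℕ.+ i) , G′ x (2 ℕ.+ (x ℕ.+ i))) ∷ (2 ℕ.+ (x ℕ.+ i) , P x (3 ℕ.+ (x ℕ.+ i))) ∷ []) λ _ _ → refl)
      (cong (λ s → s + (t₁ m + w m 2 - w m 1 + (t₁ m + + 0))) (sumBelow-w m 1 i))))
    (lemma (w m (2 ℕ.+ i)) (w (suc m) (suc i)) (w m 1) (w m 2) (w m 3) (t₁ m))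
    where
    lemma : ∀ e f w₁ w₂ w₃ a →
      let δ    = + 2 * a + w₃ - + 3 * w₂ + w₁ - + 1
          w₁′  = w₁ + + 1
          w₂′  = w₂ + w₁′
          w₃′  = w₃ + w₂′
          δ′   = + 2 * (+ 2 * a) + w₃′ - + 3 * w₂′ + w₁′ - + 1
      in e + δ + (f - w₁′ + (a + w₂ - w₁ + (a + + 0))) ≡ e + f + δ′
    lemma = solve-∀
  closedForm-suc (G j z)  = trans
    (sumKids-run (λ y d → W y (suc d)) (λ d → w m (suc d)) 0 (suc j) _ λ _ _ → refl)
    (trans (cong (λ s → s + (t₁ m + (w m (2 ℕ.+ j) - w m 1 + t₁ m + + 0))) (sumBelow-w m 0 (suc j)))
      (lemma (w m (2 ℕ.+ j)) (w (suc m) (suc j)) (w m 1) (t₁ m)))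
    where
    lemma : ∀ e f w₁ a → f - + 1 + (a + (e - w₁ + a + + 0)) ≡ e + f - (w₁ + + 1) + + 2 * a
    lemma = solve-∀
  closedForm-suc (P x z)  = lemma (t₁ m)
    where
    lemma : ∀ a → a + (a + + 0) ≡ + 2 * a
    lemma = solve-∀
  closedForm-suc (V x z)  = lemma (w m 1)
    where
    lemma : ∀ a → + 1 + (a + + 0) ≡ a + + 1
    lemma = solve-∀
  closedForm-suc (G′ x z) = lemma (t₁ m) (w m 1) (w m 2)
    where
    lemma : ∀ a w₁ w₂ → a + (a + w₂ - w₁ + (w₁ + + 0)) ≡ + 2 * a + (w₂ + (w₁ + + 1)) - (w₁ + + 1)
    lemma = solve-∀
  closedForm-suc (W x d)  = trans
    (cong sumKids (sym (++-identityʳ (run W x (suc d)))))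
    (trans (sumKids-run W (w m) x (suc d) [] λ _ _ → refl)
      (trans (ℤ.+-identityʳ _) (sumBelow-w₀ m d)))

count≡closedForm : ∀ m ℓ → count m ℓ ≡ closedForm m ℓ
count≡closedForm zero    ℓ = sym (closedForm-0 ℓ)
count≡closedForm (suc m) ℓ =
  trans (sumBy-cong (λ k → count≡closedForm m (proj₂ k)) (kids ℓ)) (closedForm-suc m ℓ)

-- Coefficients of the four fractions

earlier history : (ℕ → ℤ) → ℕ → List ℤ
earlier u zero    = []
earlier u (suc n) = history u n
history u n = u n ∷ earlier u n

-- The convolution is cut off by `zipWith`, so in the applications the indices below the degree of
-- `q` are checked separately, before the uniform recurrence sets in.
ratCoeff-unique : ∀ p q (u : ℕ → ℤ) → u 0 ≡ coeffP p 0 →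
  (∀ n → u (suc n) ≡ coeffP p (suc n) - foldr _+_ (+ 0) (zipWith _*_ (drop 1 q) (history u n))) →
  ∀ n → ratCoeff p q n ≡ u n
ratCoeff-unique p q u u-zero u-suc n = cong headZ (prefix n)
  where
  prefix : ∀ n → prefixR p q n ≡ history u n
  prefix zero    = cong (_∷ []) (sym u-zero)
  prefix (suc n) = cong₂ _∷_ (trans
    (cong (λ h → coeffP p (suc n) - foldr _+_ (+ 0) (zipWith _*_ (drop 1 q) h)) (prefix n)) (sym (u-suc n))) (prefix n)

ratCoeff-F : ∀ n → ratCoeff one ((one -P scaleP (+ 3) X) +P (X *P X)) n ≡ F n
ratCoeff-F = ratCoeff-unique one ((one -P scaleP (+ 3) X) +P (X *P X)) F refl λ
  { zero    → refl
  ; (suc n) → lemma (F n) (F (suc n))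
  }
  where
  lemma : ∀ a b → + 3 * b - a ≡ + 0 - (-[1+ 2 ] * b + (+ 1 * a + + 0))
  lemma = solve-∀

ratCoeff-1 : ∀ n → ratCoeff one (one -P X) n ≡ + 1
ratCoeff-1 = ratCoeff-unique one (one -P X) (λ _ → + 1) refl λ { zero → refl ; (suc n) → refl }

-- The numerator is 1 - (1 - x) + (1 - x)^2.
ratCoeff-w : ∀ n → ratCoeff ((one -P X) +P (X *P X)) ((one -P X) ^P 4) n ≡ w n 3 - w n 2 + w n 1
ratCoeff-w = ratCoeff-unique ((one -P X) +P (X *P X)) ((one -P X) ^P 4) (λ n → w n 3 - w n 2 + w n 1) refl λ
  { zero                → refl
  ; (suc zero)          → refl
  ; (suc (suc zero))    → refl
  ; (suc (suc (suc n))) → lemma (w n 1) (w n 2) (w n 3)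
  }
  where
  lemma : ∀ a b c →
    let a₁ = a + + 1 ; b₁ = b + a₁ ; c₁ = c + b₁
        a₂ = a₁ + + 1 ; b₂ = b₁ + a₂ ; c₂ = c₁ + b₂
        a₃ = a₂ + + 1 ; b₃ = b₂ + a₃ ; c₃ = c₂ + b₃
        a₄ = a₃ + + 1 ; b₄ = b₃ + a₄ ; c₄ = c₃ + b₄
    in c₄ - b₄ + a₄ ≡ + 0 - (-[1+ 3 ] * (c₃ - b₃ + a₃) + (+ 6 * (c₂ - b₂ + a₂) +
      (-[1+ 3 ] * (c₁ - b₁ + a₁) + (+ 1 * (c - b + a) + + 0))))
  lemma = solve-∀

-- The last fraction has degree 3 over 3, hence the separate value at 0.
u₄ : ℕ → ℤ
u₄ zero    = + 2
u₄ (suc m) = + 6 * t₁ m + + 2 * t₂ m - + 2 * t₃ m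

-- The decomposition is 2 + 6x/(1 - 2x) + 2x^2/(1 - 2x)^2 - 2x^3/(1 - 2x)^3.
ratCoeff-t : ∀ n → ratCoeff (scaleP (+ 2) ((one -P X) *P ((one -P scaleP (+ 2) X) -P (X *P X))))
  ((one -P scaleP (+ 2) X) ^P 3) n ≡ u₄ n
ratCoeff-t = ratCoeff-unique (scaleP (+ 2) ((one -P X) *P ((one -P scaleP (+ 2) X) -P (X *P X))))
  ((one -P scaleP (+ 2) X) ^P 3) u₄ refl λ
  { zero                → refl
  ; (suc zero)          → refl
  ; (suc (suc zero))    → refl
  ; (suc (suc (suc n))) → lemma (t₁ n) (t₂ n) (t₃ n)
  }
  where
  lemma : ∀ a b c →
    let a₁ = + 2 * a ; b₁ = + 2 * b + a ; c₁ = + 2 * c + b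
        a₂ = + 2 * a₁ ; b₂ = + 2 * b₁ + a₁ ; c₂ = + 2 * c₁ + b₁
        a₃ = + 2 * a₂ ; b₃ = + 2 * b₂ + a₂ ; c₃ = + 2 * c₂ + b₂
    in + 6 * a₃ + + 2 * b₃ - + 2 * c₃ ≡ + 0 - (-[1+ 5 ] * (+ 6 * a₂ + + 2 * b₂ - + 2 * c₂) +
      (+ 12 * (+ 6 * a₁ + + 2 * b₁ - + 2 * c₁) + (-[1+ 7 ] * (+ 6 * a + + 2 * b - + 2 * c) + + 0)))
  lemma = solve-∀

closedForm≡rhsCoeff : ∀ n → closedForm n Z ≡ rhsCoeff n
closedForm≡rhsCoeff n rewrite ratCoeff-F n | ratCoeff-1 n | ratCoeff-w n | ratCoeff-t n = go n
  where
  lemma : ∀ f w₁ w₂ w₃ a b c g →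
    let w₁′ = w₁ + + 1 ; w₂′ = w₂ + w₁′ ; w₃′ = w₃ + w₂′
    in f - + 2 * a + (+ 2 + w₁ + w₃ - + 4 * a - + 2 * b + + 2 * c) + + 0 * g ≡
       f + + 1 + (w₃′ - w₂′ + w₁′) - (+ 6 * a + + 2 * b - + 2 * c)
  lemma = solve-∀
  go : ∀ n → closedForm n Z ≡ F n + + 1 + (w n 3 - w n 2 + w n 1) - u₄ n
  go zero    = refl
  go (suc m) rewrite η-1 m = lemma (F (suc m)) (w m 1) (w m 2) (w m 3) (t₁ m) (t₂ m) (t₃ m) (γ m)

length-level : ∀ n → + length (level n) ≡ rhsCoeff n
length-level n = begin
  + length (level n)                       ≡⟨ length≡sumBy-1 (level n) ⟩
  sumBy (count 0 ∘ proj₂) (level n)        ≡⟨ level-count 0 n ⟩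
  count (n ℕ.+ 0) Z                        ≡⟨ cong (λ i → count i Z) (ℕ.+-identityʳ n) ⟩
  count n Z                                ≡⟨ count≡closedForm n Z ⟩
  closedForm n Z                           ≡⟨ closedForm≡rhsCoeff n ⟩
  rhsCoeff n                               ∎
  where open ≡-Reasoning

theorem3p9 : (n : ℕ) → Σ (List (Vec (Fin n) n)) λ L → Unique L × ((σ : Vec (Fin n) n) → (σ ∈ L) ⇔ InS-T σ) × (+ length L ≡ rhsCoeff n)
theorem3p9 n =
  List.map proj₁ (level n) ,
  AllPairs.map⁺ (level-distinct n) ,
  (λ σ → mk⇔ sound complete) ,
  trans (cong +_ (length-map proj₁ (level n))) (length-level n)
  where
  sound : ∀ {σ} → σ ∈ List.map proj₁ (level n) → InS-T σ
  sound σ∈ with ∈-map⁻ proj₁ σ∈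
  ... | (σ , ℓ) , ν∈ , refl with All.lookup (level-sound n) ν∈
  ...   | perm , av , _ = perm , avoiding⇒avoids σ av
  complete : ∀ {σ} → InS-T σ → σ ∈ List.map proj₁ (level n)
  complete {σ} (perm , av1243 , av2341 , av3412) =
    ∈-map⁺ proj₁ (proj₂ (level-complete σ perm (avoids⇒avoiding σ av1243 av2341 av3412)))
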